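{- Let $\Gamma=\{1324,123\}$. Then for all $n\ge0$, $$U_{\Gamma,2n}(y)=\sum_{k=0}^n\frac{(2k+1)\binom{2n}{n-k}}{n+k+1}(-y)^{n+k}\quad\text{and}\quad U_{\Gamma,2n+1}(y)=\sum_{k=0}^n\frac{2(k+1)\binom{2n+1}{n-k}}{n+k+2}(-y)^{n+k+1}.$$
   Context: For $\sigma\in\mathfrak S_n$, $\mathrm{des}(\sigma)$ is the number of $i$ with $\sigma_i>\sigma_{i+1}$. For distinct integers $\alpha=\alpha_1\cdots\alpha_r$, $\mathrm{red}(\alpha)\in\mathfrak S_r$ replaces the $i$-th smallest entry by $i$. $\sigma$ has a $\Gamma$-match starting at position $i$ if there is $j\ge1$ with $\mathrm{red}(\sigma_i\cdots\sigma_{i+j})\in\Gamma$; $\mathcal{NM}_n(\Gamma)$ is the set of $\sigma\in\mathfrak S_n$ with no $\Gamma$-match. The polynomials $U_{\Gamma,n}(y)$ are defined by $\sum_{n\ge0}U_{\Gamma,n}(y)\frac{t^n}{n!}=\left(1+\sum_{n\ge1}\frac{t^n}{n!}\sum_{\sigma\in\mathcal{NM}_n(\Gamma)}y^{1+\mathrm{des}(\sigma)}\right)^{ -1}$. -}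

module Defs where

open import Data.Nat as ℕ using (ℕ; zero; suc; _<ᵇ_; _≡ᵇ_)
open import Data.Nat.Combinatorics using (_C_)
open import Data.Bool using (Bool; true; false; _∧_; if_then_else_; not)
open import Data.List using (List; []; _∷_; map; concatMap; filter; length; upTo; inits; tails; foldr)
open import Data.Bool.ListAction using (any)
open import Data.Integer using (ℤ; +_)
open import Data.Rational using (ℚ; 0ℚ; 1ℚ; _+_; _*_; -_; _/_)

countᵇ : {X : Set} → (X → Bool) → List X → ℕ
countᵇ p []       = 0
countᵇ p (x ∷ xs) = (if p x then 1 else 0) ℕ.+ countᵇ p xs

filterᵇ : {X : Set} → (X → Bool) → List X → List X
filterᵇ p []       = []
filterᵇ p (x ∷ xs) = if p x then x ∷ filterᵇ p xs else filterᵇ p xs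

insertions : ℕ → List ℕ → List (List ℕ)
insertions x []       = (x ∷ []) ∷ []
insertions x (y ∷ ys) = (x ∷ y ∷ ys) ∷ map (y ∷_) (insertions x ys)

perms : List ℕ → List (List ℕ)
perms []       = [] ∷ []
perms (x ∷ xs) = concatMap (insertions x) (perms xs)

Sym : ℕ → List (List ℕ)
Sym n = perms (map suc (upTo n))

des : List ℕ → ℕ
des []           = 0
des (a ∷ [])     = 0
des (a ∷ b ∷ xs) = (if b <ᵇ a then 1 else 0) ℕ.+ des (b ∷ xs)

red : List ℕ → List ℕ
red α = map (λ a → suc (countᵇ (λ b → b <ᵇ a) α)) α

listEq : List ℕ → List ℕ → Bool
listEq []       []       = true
listEq (x ∷ xs) (y ∷ ys) = (x ≡ᵇ y) ∧ listEq xs ys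
listEq _        _        = false

memb : List ℕ → List (List ℕ) → Bool
memb α Γ = any (listEq α) Γ

Γ : List (List ℕ)
Γ = (1 ∷ 3 ∷ 2 ∷ 4 ∷ []) ∷ (1 ∷ 2 ∷ 3 ∷ []) ∷ []

atLeast2 : List ℕ → Bool
atLeast2 (_ ∷ _ ∷ _) = true
atLeast2 _           = false

-- σ has a Γ-match: some consecutive factor σ_i ⋯ σ_{i+j} with j ≥ 1
-- (i.e. length ≥ 2) whose reduction lies in Γ.
-- tails gives all starting positions i, inits all lengths.
hasMatch : List (List ℕ) → List ℕ → Bool
hasMatch G σ = any (λ s → any (λ f → atLeast2 f ∧ memb (red f) G) (inits s)) (tails σ)

NM : List (List ℕ) → ℕ → List (List ℕ)
NM G n = filterᵇ (λ σ → not (hasMatch G σ)) (Sym n)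

-- Polynomials in y with rational coefficients, as coefficient sequences
-- (p m = coefficient of y^m).

Poly : Set
Poly = ℕ → ℚ

const : ℚ → Poly
const c zero    = c
const c (suc _) = 0ℚ

_⊕_ : Poly → Poly → Poly
(p ⊕ q) m = p m + q m

neg : Poly → Poly
neg p m = - p m

scale : ℚ → Poly → Poly
scale c p m = c * p m

sumTo : ℕ → (ℕ → ℚ) → ℚ
sumTo zero    f = f 0
sumTo (suc m) f = sumTo m f + f (suc m)

_⊗_ : Poly → Poly → Poly
(p ⊗ q) m = sumTo m (λ i → p i * q (m ℕ.∸ i))

mono : ℚ → ℕ → Poly
mono c e m = if e ≡ᵇ m then c else 0ℚ

psum : ℕ → (ℕ → Poly) → Poly
psum n f m = sumTo n (λ k → f k m)

ℕtoℚ : ℕ → ℚ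
ℕtoℚ k = + k / 1

sgn : ℕ → ℚ
sgn zero    = 1ℚ
sgn (suc e) = - sgn e

-- A_n(y) = Σ_{σ ∈ 𝓝𝓜_n(Γ)} y^{1+des σ}  for n ≥ 1, and A_0 = 1
-- (the constant term 1 of the series being inverted).

A : List (List ℕ) → ℕ → Poly
A G zero    = const 1ℚ
A G (suc n) m = ℕtoℚ (countᵇ (λ σ → suc (des σ) ≡ᵇ m) (NM G (suc n)))

-- U is the inverse of the EGF Σ A_n t^n/n!.  Comparing coefficients of
-- t^n/n! in (Σ A_n t^n/n!)(Σ U_n t^n/n!) = 1 gives
--   U_0 = 1,   U_n = - Σ_{k=1}^{n} C(n,k) A_k U_{n-k}  (n ≥ 1).
-- Us n = U_n ∷ U_{n-1} ∷ ... ∷ U_0.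

-- given the list U_{n-1} ∷ ... ∷ U_0 (index j ↦ U_{n-1-j}),
-- compute Σ_{k=1}^{n} C(n,k) A_k U_{n-k}
convTail : List (List ℕ) → ℕ → ℕ → List Poly → Poly
convTail G n j []       = const 0ℚ
convTail G n j (u ∷ us) =
  (scale (ℕtoℚ (n C suc j)) (A G (suc j) ⊗ u)) ⊕ convTail G n (suc j) us

Us : List (List ℕ) → ℕ → List Poly
Us G zero    = const 1ℚ ∷ []
Us G (suc n) = neg (convTail G (suc n) 0 (Us G n)) ∷ Us G n

U : List (List ℕ) → ℕ → Poly
U G n with Us G n
... | []    = const 0ℚ
... | u ∷ _ = u

{-# OPTIONS --safe #-}
-- Weight an avoiding word σ by y^(1 + des σ) and a word cut into ascending bricks of length at
-- most 2, consecutive ones either ascending at their junction or forming a 1324, by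
-- (−y)^(number of bricks).  These two weights are inverse to each other for concatenation of
-- words: moving the last run of the prefix across the cut, in one direction or the other,
-- cancels all terms.  Summing over permutations turns concatenation into the product of
-- exponential generating functions, so U_n is the generating polynomial of brick words.
-- When the letters of a brick word are removed in increasing order, each one either starts a
-- brick or completes the oldest incomplete one; this turns brick words into ballot paths, which
-- are counted by reflection.
module Submission where

open import Defs
open import Data.Nat using (ℕ; suc; _+_; _*_; _∸_)
open import Data.Nat.Combinatorics using (_C_)
open import Data.Integer using (+_)
open import Data.Rational using (_/_) renaming (_*_ to _*ℚ_)
open import Relation.Binary.PropositionalEquality using (_≡_)
open import Data.Product using (_×_)

open import Data.Bool using (Bool; true; false; _∧_; _∨_; not; if_then_else_)
open import Data.Bool.ListAction using (any)
open import Data.Bool.Properties using (∧-zeroʳ; ∨-identityʳ)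
open import Data.Empty using (⊥-elim)
import Data.Integer as ℤ
import Data.Integer.Properties as ℤ
open import Data.List using (List; []; _∷_; _++_; map; concatMap; length; inits; upTo; applyUpTo; module Inits)
open import Data.List.Properties using (map-upTo; map-∘; concatMap-map; map-concatMap; concatMap-cong; length-map; length-upTo)
open import Data.List.Relation.Binary.Sublist.Propositional using (_⊆_; _∷_; _∷ʳ_; []; ⊆-refl)
open import Data.List.Relation.Binary.Sublist.Propositional.Properties using (All-resp-⊆)
open import Data.List.Relation.Unary.All as All using (All; []; _∷_)
import Data.List.Relation.Unary.All.Properties as All
open import Data.List.Relation.Unary.AllPairs as AllPairs using (AllPairs; []; _∷_)
import Data.List.Relation.Unary.AllPairs.Properties as AllPairs
open import Data.Nat using (zero; _<_; _≤_; _<?_; _<ᵇ_; _≡ᵇ_; z≤n; s≤s; z<s; s<s; s≤s⁻¹)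
open import Data.Nat.Combinatorics using (nCk+nC[k+1]≡[n+1]C[k+1]; nCn≡1; nC1≡n; k>n⇒nCk≡0)
open import Data.Nat.Properties
import Data.Nat.Solver
open import Data.Product using (_,_; ∃)
open import Data.Rational using (ℚ; 0ℚ; 1ℚ; toℚᵘ) renaming (_+_ to _+ℚ_; -_ to -ℚ_)
import Data.Rational.Properties as ℚ
open import Data.Rational.Solver using (module +-*-Solver)
open import Data.Rational.Unnormalised using (mkℚᵘ; *≡*)
import Data.Rational.Unnormalised as ℚᵘ
import Data.Rational.Unnormalised.Properties as ℚᵘ
open import Data.Sum using (inj₁; inj₂)
open import Relation.Binary using (tri<; tri≈; tri>)
open import Relation.Binary.PropositionalEquality using (_≢_; refl; sym; trans; cong; cong₂; subst; module ≡-Reasoning)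
open import Relation.Nullary using (yes; no)
open ≡-Reasoning
open +-*-Solver using (solve; _:+_; _:*_; :-_; _:=_; con)
module ℕS = Data.Nat.Solver.+-*-Solver

-- The pattern 123 keeps the ascending runs of an avoiding word at length at most 2, so both kinds
-- of words are read through a bounded window of letters, and the cancellation is proved for each
-- word separately by recursion on reading states rather than by an explicit involution. The 1324
-- junction of brick words is the defect of that cancellation: where a prefix ending in p < q > r
-- must not be continued by t, moving the run across the cut has no partner, and the term left over
-- reads r t as a pair brick behind the pair brick p q. Cutting a permutation leaves words on
-- arbitrary letters, whereas `A` refers to the letters 1, ..., n. Avoiding words therefore need
-- invariance under order isomorphism, while brick words are summed over every ascending alphabet
-- from the start. If the first letters of two consecutive pair bricks are both removed before the
-- older brick is complete, the junction descends and must be a 1324, so the second letters ascend.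
-- Hence incomplete bricks form a queue, and only its length enters the count.

infix 4 _≈_
_≈_ : Poly → Poly → Set
p ≈ q = ∀ m → p m ≡ q m

-- Polynomials in y up to equality of coefficients

0P : Poly
0P _ = 0ℚ

shift : Poly → Poly
shift p zero    = 0ℚ
shift p (suc m) = p m

+-interchange : ∀ a b c d → (a +ℚ b) +ℚ (c +ℚ d) ≡ (a +ℚ c) +ℚ (b +ℚ d)
+-interchange = solve 4 (λ a b c d → (a :+ b) :+ (c :+ d) := (a :+ c) :+ (b :+ d)) refl

sumTo-cong : ∀ n {f g : ℕ → ℚ} → (∀ i → f i ≡ g i) → sumTo n f ≡ sumTo n g
sumTo-cong zero    f≗g = f≗g 0
sumTo-cong (suc n) f≗g = cong₂ _+ℚ_ (sumTo-cong n f≗g) (f≗g (suc n))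

sumTo-+ : ∀ n (f g : ℕ → ℚ) → sumTo n (λ i → f i +ℚ g i) ≡ sumTo n f +ℚ sumTo n g
sumTo-+ zero    f g = refl
sumTo-+ (suc n) f g = trans (cong (_+ℚ (f (suc n) +ℚ g (suc n))) (sumTo-+ n f g))
  (+-interchange (sumTo n f) (sumTo n g) (f (suc n)) (g (suc n)))

sumTo-vanish : ∀ n (f : ℕ → ℚ) → (∀ k → k ≤ n → f k ≡ 0ℚ) → sumTo n f ≡ 0ℚ
sumTo-vanish zero    f f≡0 = f≡0 0 z≤n
sumTo-vanish (suc n) f f≡0 = cong₂ _+ℚ_ (sumTo-vanish n f λ k k≤n → f≡0 k (m≤n⇒m≤1+n k≤n)) (f≡0 (suc n) ≤-refl)

sumTo-head : ∀ n (f : ℕ → ℚ) → sumTo (suc n) f ≡ f 0 +ℚ sumTo n (λ i → f (suc i))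
sumTo-head zero    f = refl
sumTo-head (suc n) f = trans (cong (_+ℚ f (suc (suc n))) (sumTo-head n f)) (ℚ.+-assoc (f 0) _ _)

⊗-cong : ∀ {p p′ q q′} → p ≈ p′ → q ≈ q′ → (p ⊗ q) ≈ (p′ ⊗ q′)
⊗-cong p≈ q≈ m = sumTo-cong m λ i → cong₂ _*ℚ_ (p≈ i) (q≈ (m ∸ i))

⊗-congˡ : ∀ p {q q′} → q ≈ q′ → (p ⊗ q) ≈ (p ⊗ q′)
⊗-congˡ p q≈ m = sumTo-cong m λ i → cong (p i *ℚ_) (q≈ (m ∸ i))

⊗-congʳ : ∀ q {p p′} → p ≈ p′ → (p ⊗ q) ≈ (p′ ⊗ q)
⊗-congʳ q p≈ m = sumTo-cong m λ i → cong (_*ℚ q (m ∸ i)) (p≈ i)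

⊗-distribˡ : ∀ p q r → (p ⊗ (q ⊕ r)) ≈ ((p ⊗ q) ⊕ (p ⊗ r))
⊗-distribˡ p q r m = trans (sumTo-cong m λ i → ℚ.*-distribˡ-+ (p i) (q (m ∸ i)) (r (m ∸ i)))
  (sumTo-+ m (λ i → p i *ℚ q (m ∸ i)) (λ i → p i *ℚ r (m ∸ i)))

⊗-distribʳ : ∀ r p q → ((p ⊕ q) ⊗ r) ≈ ((p ⊗ r) ⊕ (q ⊗ r))
⊗-distribʳ r p q m = trans (sumTo-cong m λ i → ℚ.*-distribʳ-+ (r (m ∸ i)) (p i) (q i))
  (sumTo-+ m (λ i → p i *ℚ r (m ∸ i)) (λ i → q i *ℚ r (m ∸ i)))

⊗-zeroˡ : ∀ p → (0P ⊗ p) ≈ 0P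
⊗-zeroˡ p m = sumTo-vanish m _ λ i _ → ℚ.*-zeroˡ (p (m ∸ i))

⊗-zeroʳ : ∀ p → (p ⊗ 0P) ≈ 0P
⊗-zeroʳ p m = sumTo-vanish m _ λ i _ → ℚ.*-zeroʳ (p i)

shift-⊗ : ∀ p q → (shift p ⊗ q) ≈ shift (p ⊗ q)
shift-⊗ p q zero    = ℚ.*-zeroˡ (q 0)
shift-⊗ p q (suc m) = begin
  sumTo (suc m) (λ i → shift p i *ℚ q (suc m ∸ i))   ≡⟨ sumTo-head m _ ⟩
  0ℚ *ℚ q (suc m) +ℚ (p ⊗ q) m                       ≡⟨ cong (_+ℚ (p ⊗ q) m) (ℚ.*-zeroˡ (q (suc m))) ⟩
  0ℚ +ℚ (p ⊗ q) m                                    ≡⟨ ℚ.+-identityˡ _ ⟩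
  (p ⊗ q) m                                          ∎

⊗-identityˡ : ∀ p → (const 1ℚ ⊗ p) ≈ p
⊗-identityˡ p zero    = ℚ.*-identityˡ (p 0)
⊗-identityˡ p (suc m) = begin
  sumTo (suc m) (λ i → const 1ℚ i *ℚ p (suc m ∸ i))  ≡⟨ sumTo-head m _ ⟩
  1ℚ *ℚ p (suc m) +ℚ (0P ⊗ p) m                      ≡⟨ cong₂ _+ℚ_ (ℚ.*-identityˡ (p (suc m))) (⊗-zeroˡ p m) ⟩
  p (suc m) +ℚ 0ℚ                                    ≡⟨ ℚ.+-identityʳ _ ⟩
  p (suc m)                                          ∎

shift-cong : ∀ {p q} → p ≈ q → shift p ≈ shift q
shift-cong p≈q zero    = refl
shift-cong p≈q (suc m) = p≈q m

shift-⊕ : ∀ p q → shift (p ⊕ q) ≈ (shift p ⊕ shift q)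
shift-⊕ p q zero    = refl
shift-⊕ p q (suc m) = refl

shift-0 : shift 0P ≈ 0P
shift-0 zero    = refl
shift-0 (suc m) = refl

variable
  X Y : Set

Σ : (X → Poly) → List X → Poly
Σ f []       = 0P
Σ f (x ∷ xs) = f x ⊕ Σ f xs

Σ-cong : ∀ {f g : X → Poly} → (∀ x → f x ≈ g x) → ∀ xs → Σ f xs ≈ Σ g xs
Σ-cong f≈g []       m = refl
Σ-cong f≈g (x ∷ xs) m = cong₂ _+ℚ_ (f≈g x m) (Σ-cong f≈g xs m)

Σ-⊕ : ∀ (f g : X → Poly) xs → Σ (λ x → f x ⊕ g x) xs ≈ (Σ f xs ⊕ Σ g xs)
Σ-⊕ f g []       m = refl
Σ-⊕ f g (x ∷ xs) m = trans (cong ((f x m +ℚ g x m) +ℚ_) (Σ-⊕ f g xs m))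
  (+-interchange (f x m) (g x m) (Σ f xs m) (Σ g xs m))

Σ-⊗ˡ : ∀ p (f : X → Poly) xs → Σ (λ x → p ⊗ f x) xs ≈ (p ⊗ Σ f xs)
Σ-⊗ˡ p f []       m = sym (⊗-zeroʳ p m)
Σ-⊗ˡ p f (x ∷ xs) m = trans (cong ((p ⊗ f x) m +ℚ_) (Σ-⊗ˡ p f xs m))
  (sym (⊗-distribˡ p (f x) (Σ f xs) m))

Σ-++ : ∀ (f : X → Poly) xs ys → Σ f (xs ++ ys) ≈ (Σ f xs ⊕ Σ f ys)
Σ-++ f []       ys m = sym (ℚ.+-identityˡ _)
Σ-++ f (x ∷ xs) ys m = trans (cong (f x m +ℚ_) (Σ-++ f xs ys m)) (sym (ℚ.+-assoc (f x m) _ _))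

Σ-map : ∀ (f : Y → Poly) (h : X → Y) xs → Σ f (map h xs) ≈ Σ (λ x → f (h x)) xs
Σ-map f h []       m = refl
Σ-map f h (x ∷ xs) m = cong (f (h x) m +ℚ_) (Σ-map f h xs m)

Σ-concatMap : ∀ (f : Y → Poly) (h : X → List Y) xs →
  Σ f (concatMap h xs) ≈ Σ (λ x → Σ f (h x)) xs
Σ-concatMap f h []       m = refl
Σ-concatMap f h (x ∷ xs) m = trans (Σ-++ f (h x) (concatMap h xs) m)
  (cong (Σ f (h x) m +ℚ_) (Σ-concatMap f h xs m))

-- Concatenation of words

Word : Set
Word = List ℕ

insertSum : ℕ → (Word → Poly) → Word → Poly
insertSum x f w = Σ f (insertions x w)

insertSum-∷ : ∀ x f z w → insertSum x f (z ∷ w) ≈ (f (x ∷ z ∷ w) ⊕ insertSum x (λ v → f (z ∷ v)) w)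
insertSum-∷ x f z w m = cong (f (x ∷ z ∷ w) m +ℚ_) (Σ-map f (z ∷_) (insertions x w) m)

-- A letter that moves into the prefix is absorbed into `f`, so the recursion passes through the
-- functions `λ v → f (x ∷ v)`. For `avoidWeight` these are the states `α₁`, `α₂`, `α₃` up to powers
-- of y, or zero.
conv : (Word → Poly) → (Word → Poly) → Word → Poly
conv f g []      = f [] ⊗ g []
conv f g (x ∷ w) = (f [] ⊗ g (x ∷ w)) ⊕ conv (λ v → f (x ∷ v)) g w

conv-congˡ : ∀ {f f′} g → (∀ w → f w ≈ f′ w) → ∀ w → conv f g w ≈ conv f′ g w
conv-congˡ g f≈ []      = ⊗-congʳ (g []) (f≈ [])
conv-congˡ g f≈ (x ∷ w) m = cong₂ _+ℚ_ (⊗-congʳ (g (x ∷ w)) (f≈ []) m)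
  (conv-congˡ g (λ v → f≈ (x ∷ v)) w m)

conv-distribʳ : ∀ g f f′ w → conv (λ v → f v ⊕ f′ v) g w ≈ (conv f g w ⊕ conv f′ g w)
conv-distribʳ g f f′ []      = ⊗-distribʳ (g []) (f []) (f′ [])
conv-distribʳ g f f′ (x ∷ w) m = trans
  (cong₂ _+ℚ_ (⊗-distribʳ (g (x ∷ w)) (f []) (f′ []) m)
              (conv-distribʳ g (λ v → f (x ∷ v)) (λ v → f′ (x ∷ v)) w m))
  (+-interchange ((f [] ⊗ g (x ∷ w)) m) ((f′ [] ⊗ g (x ∷ w)) m) _ _)

conv-shift : ∀ f g w → conv (λ v → shift (f v)) g w ≈ shift (conv f g w)
conv-shift f g []      = shift-⊗ (f []) (g [])
conv-shift f g (x ∷ w) m = trans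
  (cong₂ _+ℚ_ (shift-⊗ (f []) (g (x ∷ w)) m) (conv-shift (λ v → f (x ∷ v)) g w m))
  (sym (shift-⊕ (f [] ⊗ g (x ∷ w)) _ m))

conv-zeroˡ : ∀ g w → conv (λ _ → 0P) g w ≈ 0P
conv-zeroˡ g []      = ⊗-zeroˡ (g [])
conv-zeroˡ g (x ∷ w) m = cong₂ _+ℚ_ (⊗-zeroˡ (g (x ∷ w)) m) (conv-zeroˡ g w m)

-- Inserting x into a word cut as v · w means inserting it into v or into w, so insertSum x is a derivation.
insertSum-conv : ∀ x f g w → insertSum x (conv f g) w ≈ (conv (insertSum x f) g w ⊕ conv f (insertSum x g) w)
insertSum-conv x f g [] m = begin
  ((f [] ⊗ g (x ∷ [])) m +ℚ (f (x ∷ []) ⊗ g []) m) +ℚ 0ℚ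
    ≡⟨ solve 2 (λ a b → (a :+ b) :+ con 0ℚ := b :+ a) refl ((f [] ⊗ g (x ∷ [])) m) ((f (x ∷ []) ⊗ g []) m) ⟩
  (f (x ∷ []) ⊗ g []) m +ℚ (f [] ⊗ g (x ∷ [])) m
    ≡⟨ cong₂ _+ℚ_ (⊗-congʳ (g []) (λ i → sym (ℚ.+-identityʳ (f (x ∷ []) i))) m)
                  (⊗-congˡ (f []) (λ i → sym (ℚ.+-identityʳ (g (x ∷ []) i))) m) ⟩
  (insertSum x f [] ⊗ g []) m +ℚ (f [] ⊗ insertSum x g []) m ∎
insertSum-conv x f g (z ∷ w) m = begin
  insertSum x (conv f g) (z ∷ w) m
    ≡⟨ insertSum-∷ x (conv f g) z w m ⟩
  (a +ℚ (b +ℚ c)) +ℚ insertSum x (λ v → (f [] ⊗ g (z ∷ v)) ⊕ conv fz g v) w m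
    ≡⟨ cong ((a +ℚ (b +ℚ c)) +ℚ_) (Σ-⊕ (λ v → f [] ⊗ g (z ∷ v)) (conv fz g) (insertions x w) m) ⟩
  (a +ℚ (b +ℚ c)) +ℚ (Σ (λ v → f [] ⊗ g (z ∷ v)) (insertions x w) m +ℚ insertSum x (conv fz g) w m)
    ≡⟨ cong₂ (λ s t → (a +ℚ (b +ℚ c)) +ℚ (s +ℚ t))
         (Σ-⊗ˡ (f []) (λ v → g (z ∷ v)) (insertions x w) m) (insertSum-conv x fz g w m) ⟩
  (a +ℚ (b +ℚ c)) +ℚ (d +ℚ (e +ℚ h))
    ≡⟨ solve 6 (λ a b c d e h → (a :+ (b :+ c)) :+ (d :+ (e :+ h)) := (b :+ (c :+ e)) :+ ((a :+ d) :+ h))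
         refl a b c d e h ⟩
  (b +ℚ (c +ℚ e)) +ℚ ((a +ℚ d) +ℚ h)
    ≡⟨ cong₂ _+ℚ_
         (cong₂ _+ℚ_ (⊗-congʳ (g (z ∷ w)) (λ i → sym (ℚ.+-identityʳ (f (x ∷ []) i))) m)
           (trans (sym (conv-distribʳ g (λ v → f (x ∷ z ∷ v)) (insertSum x fz) w m))
                  (conv-congˡ g (λ v i → sym (insertSum-∷ x f z v i)) w m)))
         (cong (_+ℚ h) (trans (sym (⊗-distribˡ (f []) (g (x ∷ z ∷ w)) (insertSum x (λ v → g (z ∷ v)) w) m))
                              (⊗-congˡ (f []) (λ i → sym (insertSum-∷ x g z w i)) m))) ⟩
  conv (insertSum x f) g (z ∷ w) m +ℚ conv f (insertSum x g) (z ∷ w) m ∎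
  where
  fz = λ v → f (z ∷ v)
  a = (f [] ⊗ g (x ∷ z ∷ w)) m
  b = (f (x ∷ []) ⊗ g (z ∷ w)) m
  c = conv (λ v → f (x ∷ z ∷ v)) g w m
  d = (f [] ⊗ insertSum x (λ v → g (z ∷ v)) w) m
  e = conv (insertSum x fz) g w m
  h = conv fz (insertSum x g) w m

-- Sums over permutations and products of exponential generating functions

permSum : (Word → Poly) → List ℕ → Poly
permSum f xs = Σ f (perms xs)

permSum-∷ : ∀ f x xs → permSum f (x ∷ xs) ≈ permSum (insertSum x f) xs
permSum-∷ f x xs = Σ-concatMap f (insertions x) (perms xs)

-- Σ H |S| |T| over the ordered splittings of an n-set into S and T.
splitSum : (ℕ → ℕ → Poly) → ℕ → Poly
splitSum H zero    = H 0 0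
splitSum H (suc n) = splitSum (λ i j → H (suc i) j) n ⊕ splitSum (λ i j → H i (suc j)) n

-- By the Leibniz rule each letter goes either to the left or to the right factor. Sums of
-- `insertSum x f` over words on `ys` are sums of `f` over words on `x ∷ ys`, so the hypothesis on
-- `f` carries over with `F` shifted by one. This is why the hypotheses range over all sublists of
-- `xs`.
permSum-conv : ∀ f g (F F′ : ℕ → Poly) xs →
  (∀ ys → ys ⊆ xs → permSum f ys ≈ F (length ys)) →
  (∀ ys → ys ⊆ xs → permSum g ys ≈ F′ (length ys)) →
  permSum (conv f g) xs ≈ splitSum (λ i j → F i ⊗ F′ j) (length xs)
permSum-conv f g F F′ [] hf hg m = trans (ℚ.+-identityʳ _) (⊗-cong {f []} {F 0} {g []} {F′ 0}
  (λ i → trans (sym (ℚ.+-identityʳ (f [] i))) (hf [] ⊆-refl i))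
  (λ i → trans (sym (ℚ.+-identityʳ (g [] i))) (hg [] ⊆-refl i)) m)
permSum-conv f g F F′ (x ∷ xs) hf hg m = begin
  permSum (conv f g) (x ∷ xs) m
    ≡⟨ permSum-∷ (conv f g) x xs m ⟩
  permSum (insertSum x (conv f g)) xs m
    ≡⟨ Σ-cong (insertSum-conv x f g) (perms xs) m ⟩
  permSum (λ w → conv (insertSum x f) g w ⊕ conv f (insertSum x g) w) xs m
    ≡⟨ Σ-⊕ (conv (insertSum x f) g) (conv f (insertSum x g)) (perms xs) m ⟩
  permSum (conv (insertSum x f) g) xs m +ℚ permSum (conv f (insertSum x g)) xs m
    ≡⟨ cong₂ _+ℚ_
         (permSum-conv (insertSum x f) g (λ i → F (suc i)) F′ xs
           (λ ys τ i → trans (sym (permSum-∷ f x ys i)) (hf (x ∷ ys) (refl ∷ τ) i)) (λ ys τ → hg ys (x ∷ʳ τ)) m)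
         (permSum-conv f (insertSum x g) F (λ j → F′ (suc j)) xs (λ ys τ → hf ys (x ∷ʳ τ))
           (λ ys τ i → trans (sym (permSum-∷ g x ys i)) (hg (x ∷ ys) (refl ∷ τ) i)) m) ⟩
  splitSum (λ i j → F i ⊗ F′ j) (suc (length xs)) m ∎

-- Multiplication by -y, the weight of one brick, and auxiliary facts on letters

nshift : Poly → Poly
nshift p = neg (shift p)

nshift-cong : ∀ {p q} → p ≈ q → nshift p ≈ nshift q
nshift-cong p≈q m = cong -ℚ_ (shift-cong p≈q m)

nshift-⊕ : ∀ p q → nshift (p ⊕ q) ≈ (nshift p ⊕ nshift q)
nshift-⊕ p q m = trans (cong -ℚ_ (shift-⊕ p q m)) (ℚ.neg-distrib-+ (shift p m) (shift q m))

nshift-neg : ∀ p → nshift (neg p) ≈ neg (nshift p)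
nshift-neg p zero    = refl
nshift-neg p (suc m) = refl

nshift-zero : ∀ {p} → p ≈ 0P → nshift p ≈ 0P
nshift-zero p≈0 zero    = refl
nshift-zero p≈0 (suc m) = cong -ℚ_ (p≈0 m)

Σ-nshift : ∀ (f : X → Poly) xs → Σ (λ x → nshift (f x)) xs ≈ nshift (Σ f xs)
Σ-nshift f []       m = sym (nshift-zero {0P} (λ _ → refl) m)
Σ-nshift f (x ∷ xs) m = trans (cong (nshift (f x) m +ℚ_) (Σ-nshift f xs m))
  (sym (nshift-⊕ (f x) (Σ f xs) m))

Σ-congAll : ∀ {f g : X → Poly} {xs} → All (λ x → f x ≈ g x) xs → Σ f xs ≈ Σ g xs
Σ-congAll []       m = refl
Σ-congAll (e ∷ es) m = cong₂ _+ℚ_ (e m) (Σ-congAll es m)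

Σ-zero : ∀ (xs : List X) → Σ (λ _ → 0P) xs ≈ 0P
Σ-zero []       m = refl
Σ-zero (x ∷ xs) m = cong (0ℚ +ℚ_) (Σ-zero xs m)

if-zero : ∀ b {p} → p ≈ 0P → (if b then p else 0P) ≈ 0P
if-zero true  p≈0 = p≈0
if-zero false p≈0 m = refl

<ᵇ-true : ∀ {m n} → m < n → (m <ᵇ n) ≡ true
<ᵇ-true z<s               = refl
<ᵇ-true (s<s m<n@(s≤s _)) = <ᵇ-true m<n

<ᵇ-false : ∀ {m n} → n ≤ m → (m <ᵇ n) ≡ false
<ᵇ-false {zero}  z≤n       = refl
<ᵇ-false {suc m} z≤n       = refl
<ᵇ-false         (s≤s n≤m) = <ᵇ-false n≤m

<ᵇ-trans : ∀ i j k → (i <ᵇ j) ≡ true → (j <ᵇ k) ≡ true → (i <ᵇ k) ≡ true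
<ᵇ-trans zero    (suc j) (suc k) _ _ = refl
<ᵇ-trans (suc i) (suc j) (suc k) e f = <ᵇ-trans i j k e f

<ᵇ-irrefl : ∀ i → (i <ᵇ i) ≡ false
<ᵇ-irrefl zero    = refl
<ᵇ-irrefl (suc i) = <ᵇ-irrefl i

<ᵇ-flip : ∀ i j → i ≢ j → (j <ᵇ i) ≡ not (i <ᵇ j)
<ᵇ-flip zero    zero    i≢j = ⊥-elim (i≢j refl)
<ᵇ-flip zero    (suc j) i≢j = refl
<ᵇ-flip (suc i) zero    i≢j = refl
<ᵇ-flip (suc i) (suc j) i≢j = <ᵇ-flip i j (λ i≡j → i≢j (cong suc i≡j))

insertions-All : ∀ {Q : ℕ → Set} {x w} → Q x → All Q w → All (All Q) (insertions x w)
insertions-All qx []        = (qx ∷ []) ∷ []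
insertions-All qx (qz ∷ qw) = (qx ∷ qz ∷ qw) ∷ All.map⁺ (All.map (qz ∷_) (insertions-All qx qw))

perms-All : ∀ {Q : ℕ → Set} {xs} → All Q xs → All (All Q) (perms xs)
perms-All []         = [] ∷ []
perms-All (qx ∷ qxs) = All.concat⁺ (All.map⁺ (All.map (insertions-All qx) (perms-All qxs)))

-- Avoiding words and brick words

matches1324 : ℕ → ℕ → ℕ → ℕ → Bool
matches1324 p q r t = (p <ᵇ r) ∧ ((r <ᵇ q) ∧ (q <ᵇ t))

-- Weight of continuing an avoiding word whose last ascending run is p (α₁) or p q (α₂), or
-- whose last three letters are p < q > r (α₃), where 1324 is still to be excluded.
α₁ : ℕ → Word → Poly
α₂ : ℕ → ℕ → Word → Poly
α₃ : ℕ → ℕ → ℕ → Word → Poly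

α₁ p []      = const 1ℚ
α₁ p (q ∷ w) = if p <ᵇ q then α₂ p q w else shift (α₁ q w)

α₂ p q []      = const 1ℚ
α₂ p q (r ∷ w) = if q <ᵇ r then 0P else shift (α₃ p q r w)

α₃ p q r []      = const 1ℚ
α₃ p q r (t ∷ w) = if matches1324 p q r t then 0P else α₁ r (t ∷ w)

avoidWeight : Word → Poly
avoidWeight []      = const 1ℚ
avoidWeight (p ∷ w) = shift (α₁ p w)

-- Sum of (−y)^(number of bricks) over the ways to cut a word into ascending bricks of length 1
-- or 2 such that two consecutive bricks either ascend at their junction or form a 1324.
-- after₁ p and after₂ p q are the sums over what may follow a brick p or p q.
brickWeight : Word → Poly
after₁      : ℕ → Word → Poly
pair        : ℕ → Word → Poly
after₂      : ℕ → ℕ → Word → Poly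
cross       : ℕ → ℕ → ℕ → Word → Poly

brickWeight []      = const 1ℚ
brickWeight (p ∷ w) = nshift (after₁ p w ⊕ pair p w)

after₁ p []      = const 1ℚ
after₁ p (q ∷ w) = if p <ᵇ q then brickWeight (q ∷ w) else 0P

pair p []      = 0P
pair p (q ∷ w) = if p <ᵇ q then after₂ p q w else 0P

after₂ p q []      = const 1ℚ
after₂ p q (r ∷ w) = if q <ᵇ r then brickWeight (r ∷ w) else cross p q r w

cross p q r []      = 0P
cross p q r (t ∷ w) = if matches1324 p q r t then nshift (after₂ r t w) else 0P

brickWeight-shift-cancel : ∀ {p} w {q} → q ≈ (after₁ p w ⊕ pair p w) → (brickWeight (p ∷ w) ⊕ shift q) ≈ 0P
brickWeight-shift-cancel {p} w {q} q≈ m = trans (cong (brickWeight (p ∷ w) m +ℚ_) (shift-cong q≈ m))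
  (ℚ.+-inverseˡ (shift (after₁ p w ⊕ pair p w) m))

matches1324⇒r<t : ∀ p q r t → matches1324 p q r t ≡ true → (r <ᵇ t) ≡ true
matches1324⇒r<t p q r t eq with p <ᵇ r | r <ᵇ q in r<q | q <ᵇ t in q<t
... | true | true | true = <ᵇ-trans r q t r<q q<t

-- Unless p q r t is a 1324, `α₃` continues like `α₁` and everything cancels. If it is one, the
-- prefix must stop before t, and only the readings of r as a one-letter brick find a partner; those
-- with the pair brick r t survive and make up `cross`.
conv-α₃ : ∀ p q r w → conv (α₁ r) brickWeight w ≈ (after₁ r w ⊕ pair r w) →
  (brickWeight (r ∷ w) ⊕ shift (conv (α₃ p q r) brickWeight w)) ≈ cross p q r w
conv-α₃ p q r []      ih m = brickWeight-shift-cancel {r} [] ih m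
conv-α₃ p q r (t ∷ w) ih m with matches1324 p q r t in match
... | false = brickWeight-shift-cancel (t ∷ w) ih m
-- A 1324 has r < t, so `brickWeight (r ∷ t ∷ w)` contains both readings of r.
... | true rewrite matches1324⇒r<t p q r t match = begin
  -ℚ shift (brickWeight (t ∷ w) ⊕ after₂ r t w) m +ℚ shift ((const 1ℚ ⊗ brickWeight (t ∷ w)) ⊕ conv (λ _ → 0P) brickWeight w) m
    ≡⟨ cong₂ (λ i j → -ℚ i +ℚ j) (shift-⊕ (brickWeight (t ∷ w)) (after₂ r t w) m)
         (shift-cong (λ i → trans (cong₂ _+ℚ_ (⊗-identityˡ (brickWeight (t ∷ w)) i) (conv-zeroˡ brickWeight w i))
                                  (ℚ.+-identityʳ (brickWeight (t ∷ w) i))) m) ⟩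
  -ℚ (shift (brickWeight (t ∷ w)) m +ℚ shift (after₂ r t w) m) +ℚ shift (brickWeight (t ∷ w)) m
    ≡⟨ solve 2 (λ i j → :- (i :+ j) :+ i := :- j) refl (shift (brickWeight (t ∷ w)) m) (shift (after₂ r t w) m) ⟩
  nshift (after₂ r t w) m ∎

-- With p already in the prefix, the surviving terms are the readings of p as first letter of a
-- brick, without the factor -y of that brick. Multiplied by y they cancel the cut just before p,
-- and this is what happens at each descent.
conv-α₁ : ∀ p w → conv (α₁ p) brickWeight w ≈ (after₁ p w ⊕ pair p w)
conv-α₂ : ∀ p q w → conv (α₂ p q) brickWeight w ≈ after₂ p q w

conv-α₁ p []      m = trans (⊗-identityˡ (const 1ℚ) m) (sym (ℚ.+-identityʳ _))
conv-α₁ p (q ∷ w) m with p <ᵇ q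
... | true  = cong₂ _+ℚ_ (⊗-identityˡ (brickWeight (q ∷ w)) m) (conv-α₂ p q w m)
... | false = trans
  (cong₂ _+ℚ_ (⊗-identityˡ (brickWeight (q ∷ w)) m) (conv-shift (α₁ q) brickWeight w m))
  (brickWeight-shift-cancel w (conv-α₁ q w) m)

conv-α₂ p q []      m = ⊗-identityˡ (const 1ℚ) m
conv-α₂ p q (r ∷ w) m with q <ᵇ r
... | true  = trans (cong₂ _+ℚ_ (⊗-identityˡ (brickWeight (r ∷ w)) m) (conv-zeroˡ brickWeight w m)) (ℚ.+-identityʳ _)
... | false = trans (cong₂ _+ℚ_ (⊗-identityˡ (brickWeight (r ∷ w)) m) (conv-shift (α₃ p q r) brickWeight w m))
  (conv-α₃ p q r w (conv-α₁ r w) m)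

conv-avoid-brick : ∀ p w → conv avoidWeight brickWeight (p ∷ w) ≈ 0P
conv-avoid-brick p w m = trans
  (cong₂ _+ℚ_ (⊗-identityˡ (brickWeight (p ∷ w)) m) (conv-shift (α₁ p) brickWeight w m))
  (brickWeight-shift-cancel w (conv-α₁ p w) m)

-- Removing the least letter of a brick word

-- The first letters of consecutive bricks increase, so a word whose least letter is not in
-- front has brickWeight 0.
data Buried (x : ℕ) : Word → Set where
  here  : ∀ {w} → Buried x (x ∷ w)
  there : ∀ {z w} → x < z → Buried x w → Buried x (z ∷ w)

insertions-Buried : ∀ {x w} → All (x <_) w → All (Buried x) (insertions x w)
insertions-Buried []          = here ∷ []
insertions-Buried (x<z ∷ x<w) = here ∷ All.map⁺ (All.map (there x<z) (insertions-Buried x<w))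

insertSum-Buried : ∀ {x f w} → (∀ {v} → Buried x v → f v ≈ 0P) → All (x <_) w → insertSum x f w ≈ 0P
insertSum-Buried {x} {f} {w} f≈0 x<w m = trans (Σ-congAll (All.map f≈0 (insertions-Buried x<w)) m)
  (Σ-zero (insertions x w) m)

-- In each reading state the letter x would have to exceed an earlier letter: as second letter of a
-- brick, after an ascending junction, or as third or fourth letter of a 1324.
brickWeight-Buried : ∀ {x p w} → x < p → Buried x w → brickWeight (p ∷ w) ≈ 0P
after₂-Buried      : ∀ {x p q w} → x < p → x < q → Buried x w → after₂ p q w ≈ 0P
cross-Buried       : ∀ {x q r w} p → x < q → x < r → Buried x w → cross p q r w ≈ 0P

brickWeight-Buried x<p here rewrite <ᵇ-false (<⇒≤ x<p) = nshift-zero λ _ → refl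
brickWeight-Buried {p = p} x<p (there {z} x<z b) = nshift-zero λ m →
  cong₂ _+ℚ_ (if-zero (p <ᵇ z) (brickWeight-Buried x<z b) m) (if-zero (p <ᵇ z) (after₂-Buried x<p x<z b) m)

after₂-Buried x<p x<q (here {[]}) rewrite <ᵇ-false (<⇒≤ x<q) = λ _ → refl
after₂-Buried x<p x<q (here {t ∷ w}) rewrite <ᵇ-false (<⇒≤ x<q) | <ᵇ-false (<⇒≤ x<p) = λ _ → refl
after₂-Buried {p = p} {q} x<p x<q (there {z} x<z b) with q <ᵇ z
... | true  = brickWeight-Buried x<z b
... | false = cross-Buried p x<q x<z b

cross-Buried {q = q} {r} p x<q x<r here
  rewrite <ᵇ-false (<⇒≤ x<q) | ∧-zeroʳ (r <ᵇ q) | ∧-zeroʳ (p <ᵇ r) = λ _ → refl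
cross-Buried {q = q} {r} p x<q x<r (there {z} x<z b) =
  if-zero (matches1324 p q r z) (nshift-zero (after₂-Buried x<r x<z b))

-- queued p h is the sum over brick words with h bricks of length 2 still lacking their first
-- letters: the word begins with the letters that complete these bricks, oldest first.  The
-- removed first letter of the youngest one is p.
queued : ℕ → ℕ → Word → Poly
queued p zero          w           = brickWeight w
queued p (suc h)       []          = 0P
queued p (suc zero)    (q ∷ w)     = after₂ p q w
queued p (suc (suc h)) (q ∷ [])    = 0P
queued p (suc (suc h)) (q ∷ r ∷ w) = if q <ᵇ r then queued p (suc h) (r ∷ w) else 0P

-- The least letter must stand in front; the two summands read it as a one-letter brick and as the
-- first letter of a pair.
insertSum-queued-zero : ∀ {x w} p → All (x <_) w → insertSum x (queued p 0) w ≈ nshift (queued p 0 w ⊕ queued x 1 w)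
insertSum-queued-zero p [] m = ℚ.+-identityʳ _
insertSum-queued-zero {x} {z ∷ w} p (x<z ∷ x<w) m = begin
  insertSum x brickWeight (z ∷ w) m
    ≡⟨ insertSum-∷ x brickWeight z w m ⟩
  brickWeight (x ∷ z ∷ w) m +ℚ insertSum x (λ v → brickWeight (z ∷ v)) w m
    ≡⟨ cong (brickWeight (x ∷ z ∷ w) m +ℚ_) (insertSum-Buried (brickWeight-Buried x<z) x<w m) ⟩
  brickWeight (x ∷ z ∷ w) m +ℚ 0ℚ
    ≡⟨ ℚ.+-identityʳ _ ⟩
  brickWeight (x ∷ z ∷ w) m
    ≡⟨ cong (λ b → nshift ((if b then brickWeight (z ∷ w) else 0P) ⊕ (if b then after₂ x z w else 0P)) m) (<ᵇ-true x<z) ⟩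
  nshift (brickWeight (z ∷ w) ⊕ after₂ x z w) m ∎

-- Between two letters that complete queued bricks, x would break their required ascent. Right
-- behind the last of them it can only be the third letter of a 1324, hence the start of a new pair
-- brick; further to the right it is buried.
insertSum-queued-tail : ∀ {p x z w} h → p < x → x < z → All (x <_) w →
  insertSum x (λ v → queued p (suc h) (z ∷ v)) w ≈ nshift (queued x (suc (suc h)) (z ∷ w))
insertSum-queued-tail zero p<x x<z [] m rewrite <ᵇ-false (<⇒≤ x<z) =
  sym (nshift-zero {0P} (λ _ → refl) m)
insertSum-queued-tail {p} {x} {z} {q ∷ w} zero p<x x<z (x<q ∷ x<w) m = begin
  insertSum x (after₂ p z) (q ∷ w) m
    ≡⟨ insertSum-∷ x (after₂ p z) q w m ⟩
  after₂ p z (x ∷ q ∷ w) m +ℚ insertSum x (λ v → after₂ p z (q ∷ v)) w m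
    ≡⟨ cong₂ _+ℚ_ front (insertSum-Buried rest x<w m) ⟩
  nshift (if z <ᵇ q then after₂ x q w else 0P) m +ℚ 0ℚ
    ≡⟨ ℚ.+-identityʳ _ ⟩
  nshift (if z <ᵇ q then after₂ x q w else 0P) m ∎
  where
  front : after₂ p z (x ∷ q ∷ w) m ≡ nshift (if z <ᵇ q then after₂ x q w else 0P) m
  front rewrite <ᵇ-false (<⇒≤ x<z) | <ᵇ-true p<x | <ᵇ-true x<z with z <ᵇ q
  ... | true  = refl
  ... | false = sym (nshift-zero {0P} (λ _ → refl) m)
  rest : ∀ {v} → Buried x v → after₂ p z (q ∷ v) ≈ 0P
  rest b with z <ᵇ q
  ... | true  = brickWeight-Buried x<q b
  ... | false = cross-Buried p x<z x<q b
insertSum-queued-tail (suc h) p<x x<z [] m rewrite <ᵇ-false (<⇒≤ x<z) =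
  sym (nshift-zero {0P} (λ _ → refl) m)
insertSum-queued-tail {p} {x} {z} {q ∷ w} (suc h) p<x x<z (x<q ∷ x<w) m = begin
  insertSum x (λ v → queued p (suc (suc h)) (z ∷ v)) (q ∷ w) m
    ≡⟨ insertSum-∷ x (λ v → queued p (suc (suc h)) (z ∷ v)) q w m ⟩
  (if z <ᵇ x then queued p (suc h) (x ∷ q ∷ w) else 0P) m
    +ℚ insertSum x (λ v → if z <ᵇ q then queued p (suc h) (q ∷ v) else 0P) w m
    ≡⟨ cong₂ _+ℚ_ (cong (λ b → (if b then queued p (suc h) (x ∷ q ∷ w) else 0P) m) (<ᵇ-false (<⇒≤ x<z))) rest ⟩
  0ℚ +ℚ nshift (if z <ᵇ q then queued x (suc (suc h)) (q ∷ w) else 0P) m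
    ≡⟨ ℚ.+-identityˡ _ ⟩
  nshift (if z <ᵇ q then queued x (suc (suc h)) (q ∷ w) else 0P) m ∎
  where
  rest : insertSum x (λ v → if z <ᵇ q then queued p (suc h) (q ∷ v) else 0P) w m ≡
         nshift (if z <ᵇ q then queued x (suc (suc h)) (q ∷ w) else 0P) m
  rest with z <ᵇ q
  ... | true  = insertSum-queued-tail h p<x x<q x<w m
  ... | false = trans (Σ-zero (insertions x w) m) (sym (nshift-zero {0P} (λ _ → refl) m))

-- In front, x completes the oldest incomplete brick; behind the queue it starts the youngest. The
-- hypothesis p < x supplies the comparison of first and third letter in the 1324.
insertSum-queued-suc : ∀ {p x w} h → p < x → All (x <_) w →
  insertSum x (queued p (suc h)) w ≈ (queued p h w ⊕ nshift (queued x (suc (suc h)) w))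
insertSum-queued-suc zero    p<x [] m = cong (const 1ℚ m +ℚ_) (sym (nshift-zero {0P} (λ _ → refl) m))
insertSum-queued-suc (suc h) p<x [] m = cong (0ℚ +ℚ_) (sym (nshift-zero {0P} (λ _ → refl) m))
insertSum-queued-suc {p} {x} {z ∷ w} h p<x (x<z ∷ x<w) m =
  trans (insertSum-∷ x (queued p (suc h)) z w m) (cong₂ _+ℚ_ (front h) (insertSum-queued-tail h p<x x<z x<w m))
  where
  front : ∀ h → queued p (suc h) (x ∷ z ∷ w) m ≡ queued p h (z ∷ w) m
  front zero    rewrite <ᵇ-true x<z = refl
  front (suc h) rewrite <ᵇ-true x<z = refl

-- From brick words to ballot paths

-- Paths of n up (weight −y) and down steps starting at height h and never going below 0.
ballot : ℕ → ℕ → Poly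
ballot zero    h       = const 1ℚ
ballot (suc n) zero    = nshift (ballot n 1)
ballot (suc n) (suc h) = nshift (ballot n (suc (suc h))) ⊕ ballot n h

-- Bricks of length 1 become the up steps from whose height the path never comes down again, so
-- queued p h counts the paths from height h that touch 0; those that do not are the paths from
-- height h − 1.
permSum-queued-zero : ∀ {p xs} → All (p <_) xs → AllPairs _<_ xs → permSum (queued p 0) xs ≈ ballot (length xs) 0
permSum-queued-suc  : ∀ {p xs} h → All (p <_) xs → AllPairs _<_ xs →
  permSum (queued p (suc h)) xs ≈ (ballot (length xs) (suc h) ⊕ neg (ballot (length xs) h))

permSum-queued-zero []  []  m = ℚ.+-identityʳ _
permSum-queued-zero {p} {x ∷ xs} (p<x ∷ p<xs) (x<xs ∷ asc) m = begin
  permSum (queued p 0) (x ∷ xs) m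
    ≡⟨ permSum-∷ (queued p 0) x xs m ⟩
  permSum (insertSum x (queued p 0)) xs m
    ≡⟨ Σ-congAll (All.map (insertSum-queued-zero p) (perms-All x<xs)) m ⟩
  permSum (λ w → nshift (queued p 0 w ⊕ queued x 1 w)) xs m
    ≡⟨ Σ-nshift (λ w → queued p 0 w ⊕ queued x 1 w) (perms xs) m ⟩
  nshift (permSum (λ w → queued p 0 w ⊕ queued x 1 w) xs) m
    ≡⟨ nshift-cong (λ i → trans (Σ-⊕ (queued p 0) (queued x 1) (perms xs) i)
         (trans (cong₂ _+ℚ_ (permSum-queued-zero p<xs asc i) (permSum-queued-suc 0 x<xs asc i))
           (solve 2 (λ j k → j :+ (k :+ :- j) := k) refl (ballot n 0 i) (ballot n 1 i)))) m ⟩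
  nshift (ballot n 1) m ∎
  where n = length xs

permSum-queued-suc h []  []  m = sym (ℚ.+-inverseʳ (const 1ℚ m))
permSum-queued-suc {p} {x ∷ xs} h (p<x ∷ p<xs) (x<xs ∷ asc) m = begin
  permSum (queued p (suc h)) (x ∷ xs) m
    ≡⟨ permSum-∷ (queued p (suc h)) x xs m ⟩
  permSum (insertSum x (queued p (suc h))) xs m
    ≡⟨ Σ-congAll (All.map (insertSum-queued-suc h p<x) (perms-All x<xs)) m ⟩
  permSum (λ w → queued p h w ⊕ nshift (queued x (suc (suc h)) w)) xs m
    ≡⟨ Σ-⊕ (queued p h) (λ w → nshift (queued x (suc (suc h)) w)) (perms xs) m ⟩
  permSum (queued p h) xs m +ℚ permSum (λ w → nshift (queued x (suc (suc h)) w)) xs m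
    ≡⟨ cong (permSum (queued p h) xs m +ℚ_) (trans (Σ-nshift (queued x (suc (suc h))) (perms xs) m)
         (trans (nshift-cong (permSum-queued-suc (suc h) x<xs asc) m)
           (trans (nshift-⊕ (ballot n (suc (suc h))) (neg (ballot n (suc h))) m)
             (cong (nshift (ballot n (suc (suc h))) m +ℚ_) (nshift-neg (ballot n (suc h)) m))))) ⟩
  permSum (queued p h) xs m +ℚ (nshift (ballot n (suc (suc h))) m +ℚ -ℚ nshift (ballot n (suc h)) m)
    ≡⟨ last h ⟩
  ballot (suc n) (suc h) m +ℚ -ℚ ballot (suc n) h m ∎
  where
  n = length xs
  last : ∀ h → permSum (queued p h) xs m +ℚ (nshift (ballot n (suc (suc h))) m +ℚ -ℚ nshift (ballot n (suc h)) m)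
             ≡ ballot (suc n) (suc h) m +ℚ -ℚ ballot (suc n) h m
  last zero = trans (cong (_+ℚ (nshift (ballot n 2) m +ℚ -ℚ nshift (ballot n 1) m)) (permSum-queued-zero p<xs asc m))
    (solve 3 (λ i j k → i :+ (j :+ :- k) := (j :+ i) :+ :- k) refl
      (ballot n 0 m) (nshift (ballot n 2) m) (nshift (ballot n 1) m))
  last (suc h) = trans
    (cong (_+ℚ (nshift (ballot n (suc (suc (suc h)))) m +ℚ -ℚ nshift (ballot n (suc (suc h))) m))
      (permSum-queued-suc h p<xs asc m))
    (solve 4 (λ i j k l → (i :+ :- l) :+ (j :+ :- k) := (j :+ i) :+ :- (k :+ l)) refl
      (ballot n (suc h) m) (nshift (ballot n (suc (suc (suc h)))) m) (nshift (ballot n (suc (suc h))) m) (ballot n h m))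

permSum-brickWeight : ∀ {xs} → All (0 <_) xs → AllPairs _<_ xs → permSum brickWeight xs ≈ ballot (length xs) 0
permSum-brickWeight = permSum-queued-zero

if-≈ : ∀ b {p q r} → (b ≡ true → p ≈ r) → (b ≡ false → q ≈ r) → (if b then p else q) ≈ r
if-≈ true  t f = t refl
if-≈ false t f = f refl

suc-upTo-ascending : ∀ n → AllPairs _<_ (map suc (upTo n))
suc-upTo-ascending n rewrite map-upTo suc n = AllPairs.applyUpTo⁺₁ suc n (λ i<j _ → s<s i<j)

-- Matches of Γ in words with distinct letters

Distinct : Word → Set
Distinct = AllPairs _≢_

factorIn : Word → Bool
factorIn f = atLeast2 f ∧ memb (red f) Γ

listEq-length : ∀ xs ys → length xs ≢ length ys → listEq xs ys ≡ false
listEq-length []       []       l = ⊥-elim (l refl)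
listEq-length []       (y ∷ ys) l = refl
listEq-length (x ∷ xs) []       l = refl
listEq-length (x ∷ xs) (y ∷ ys) l
  rewrite listEq-length xs ys (λ e → l (cong suc e)) = ∧-zeroʳ (x ≡ᵇ y)

factorIn-2 : ∀ i j → factorIn (i ∷ j ∷ []) ≡ false
factorIn-2 i j
  rewrite listEq-length (red (i ∷ j ∷ [])) (1 ∷ 3 ∷ 2 ∷ 4 ∷ []) (λ ())
        | listEq-length (red (i ∷ j ∷ [])) (1 ∷ 2 ∷ 3 ∷ []) (λ ()) = refl

factorIn-5 : ∀ i j k l n w → factorIn (i ∷ j ∷ k ∷ l ∷ n ∷ w) ≡ false
factorIn-5 i j k l n w
  rewrite listEq-length (red (i ∷ j ∷ k ∷ l ∷ n ∷ w)) (1 ∷ 3 ∷ 2 ∷ 4 ∷ []) (λ ())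
        | listEq-length (red (i ∷ j ∷ k ∷ l ∷ n ∷ w)) (1 ∷ 2 ∷ 3 ∷ []) (λ ()) = refl

factorIn-≥5 : ∀ i j k l n ws →
  any factorIn (map (i ∷_) (map (j ∷_) (map (k ∷_) (map (l ∷_) (map (n ∷_) ws))))) ≡ false
factorIn-≥5 i j k l n []       = refl
factorIn-≥5 i j k l n (w ∷ ws) rewrite factorIn-5 i j k l n w = factorIn-≥5 i j k l n ws

⟦_⟧ : Bool → ℕ
⟦ b ⟧ = if b then 1 else 0

-- In terms of the comparisons ij = (i < j), …, the entries of red are the scores of a tournament,
-- and a tournament whose scores are all distinct is transitive.
scores123 : ∀ ij ik jk →
  listEq (suc (⟦ not ij ⟧ + (⟦ not ik ⟧ + 0)) ∷ suc (⟦ ij ⟧ + (⟦ not jk ⟧ + 0)) ∷ suc (⟦ ik ⟧ + (⟦ jk ⟧ + 0)) ∷ [])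
         (1 ∷ 2 ∷ 3 ∷ [])
  ≡ ij ∧ (ik ∧ jk)
scores123 false _     _     = refl
scores123 true  false _     = refl
scores123 true  true  false = refl
scores123 true  true  true  = refl

scores1324 : ∀ ij ik il kj jl kl →
  listEq (suc (⟦ not ij ⟧ + (⟦ not ik ⟧ + (⟦ not il ⟧ + 0)))
        ∷ suc (⟦ ij ⟧ + (⟦ kj ⟧ + (⟦ not jl ⟧ + 0)))
        ∷ suc (⟦ ik ⟧ + (⟦ not kj ⟧ + (⟦ not kl ⟧ + 0)))
        ∷ suc (⟦ il ⟧ + (⟦ jl ⟧ + (⟦ kl ⟧ + 0))) ∷ [])
         (1 ∷ 3 ∷ 2 ∷ 4 ∷ [])
  ≡ ij ∧ (ik ∧ (il ∧ (kj ∧ (jl ∧ kl))))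
scores1324 false _     _     _     _     _     = refl
scores1324 true  false _     _     _     _     = refl
scores1324 true  true  false _     _     _     = refl
scores1324 true  true  true  true  true  true  = refl
scores1324 true  true  true  true  true  false = refl
scores1324 true  true  true  true  false _     = refl
scores1324 true  true  true  false true  _     = refl
scores1324 true  true  true  false false true  = refl
scores1324 true  true  true  false false false = refl

-- Distinctness turns j < i into the negation of i < j, which brings the entries of `red` into the
-- form of `scores123`; transitivity then absorbs i < k.
factorIn-3 : ∀ i j k → Distinct (i ∷ j ∷ k ∷ []) → factorIn (i ∷ j ∷ k ∷ []) ≡ (i <ᵇ j) ∧ (j <ᵇ k)
factorIn-3 i j k ((i≢j ∷ i≢k ∷ []) ∷ (j≢k ∷ []) ∷ _)
  rewrite listEq-length (red (i ∷ j ∷ k ∷ [])) (1 ∷ 3 ∷ 2 ∷ 4 ∷ []) (λ ())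
        | <ᵇ-irrefl i | <ᵇ-irrefl j | <ᵇ-irrefl k
        | <ᵇ-flip i j i≢j | <ᵇ-flip i k i≢k | <ᵇ-flip j k j≢k
        | scores123 (i <ᵇ j) (i <ᵇ k) (j <ᵇ k)
  with i <ᵇ j in i<j | j <ᵇ k in j<k
... | false | _     = refl
... | true  | false rewrite ∧-zeroʳ (i <ᵇ k) = refl
... | true  | true  rewrite <ᵇ-trans i j k i<j j<k = refl

factorIn-4 : ∀ i j k l → Distinct (i ∷ j ∷ k ∷ l ∷ []) → factorIn (i ∷ j ∷ k ∷ l ∷ []) ≡ matches1324 i j k l
factorIn-4 i j k l ((i≢j ∷ i≢k ∷ i≢l ∷ []) ∷ (j≢k ∷ j≢l ∷ []) ∷ (k≢l ∷ []) ∷ _)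
  rewrite listEq-length (red (i ∷ j ∷ k ∷ l ∷ [])) (1 ∷ 2 ∷ 3 ∷ []) (λ ())
        | <ᵇ-irrefl i | <ᵇ-irrefl j | <ᵇ-irrefl k | <ᵇ-irrefl l
        | <ᵇ-flip i j i≢j | <ᵇ-flip i k i≢k | <ᵇ-flip i l i≢l
        | <ᵇ-flip k j (λ k≡j → j≢k (sym k≡j)) | <ᵇ-flip j l j≢l | <ᵇ-flip k l k≢l
        | scores1324 (i <ᵇ j) (i <ᵇ k) (i <ᵇ l) (k <ᵇ j) (j <ᵇ l) (k <ᵇ l)
  with i <ᵇ k in i<k | k <ᵇ j in k<j | j <ᵇ l in j<l
... | false | _     | _     rewrite ∧-zeroʳ (i <ᵇ j) = refl
... | true  | false | _     rewrite ∧-zeroʳ (i <ᵇ l) | ∧-zeroʳ (i <ᵇ j) = refl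
... | true  | true  | false rewrite ∧-zeroʳ (i <ᵇ l) | ∧-zeroʳ (i <ᵇ j) = refl
... | true  | true  | true
  rewrite <ᵇ-trans i k j i<k k<j | <ᵇ-trans k j l k<j j<l | <ᵇ-trans i k l i<k (<ᵇ-trans k j l k<j j<l) = refl

startsMatch : Word → Bool
startsMatch (i ∷ j ∷ k ∷ [])    = (i <ᵇ j) ∧ (j <ᵇ k)
startsMatch (i ∷ j ∷ k ∷ l ∷ w) = ((i <ᵇ j) ∧ (j <ᵇ k)) ∨ matches1324 i j k l
startsMatch _                   = false

-- The prefixes of length other than 3 and 4 fail by length alone.
any-inits : ∀ w → Distinct w → any factorIn (inits w) ≡ startsMatch w
any-inits []          _ = refl
any-inits (i ∷ [])    _ = refl
any-inits (i ∷ j ∷ []) _ rewrite factorIn-2 i j = refl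
any-inits (i ∷ j ∷ k ∷ []) d rewrite factorIn-2 i j | factorIn-3 i j k d = ∨-identityʳ _
any-inits (i ∷ j ∷ k ∷ l ∷ []) d@((i≢j ∷ i≢k ∷ _) ∷ (j≢k ∷ _) ∷ _)
  rewrite factorIn-2 i j | factorIn-3 i j k ((i≢j ∷ i≢k ∷ []) ∷ (j≢k ∷ []) ∷ [] ∷ []) | factorIn-4 i j k l d =
  cong (((i <ᵇ j) ∧ (j <ᵇ k)) ∨_) (∨-identityʳ _)
any-inits (i ∷ j ∷ k ∷ l ∷ n ∷ w) ((i≢j ∷ i≢k ∷ i≢l ∷ _) ∷ (j≢k ∷ j≢l ∷ _) ∷ (k≢l ∷ _) ∷ _)
  rewrite factorIn-2 i j | factorIn-3 i j k ((i≢j ∷ i≢k ∷ []) ∷ (j≢k ∷ []) ∷ [] ∷ [])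
        | factorIn-4 i j k l ((i≢j ∷ i≢k ∷ i≢l ∷ []) ∷ (j≢k ∷ j≢l ∷ []) ∷ (k≢l ∷ []) ∷ [] ∷ [])
        | factorIn-5 i j k l n [] =
  cong (((i <ᵇ j) ∧ (j <ᵇ k)) ∨_) (trans (cong (matches1324 i j k l ∨_)
    (factorIn-≥5 i j k l n (Inits.tail w))) (∨-identityʳ _))

hasMatch-∷ : ∀ {i w} → Distinct (i ∷ w) → hasMatch Γ (i ∷ w) ≡ startsMatch (i ∷ w) ∨ hasMatch Γ w
hasMatch-∷ {i} {w} d = cong (_∨ hasMatch Γ w) (any-inits (i ∷ w) d)

-- Both patterns begin with an ascent; for `matches1324` it is implied by i < k < j.
startsMatch-desc : ∀ i j w → (i <ᵇ j) ≡ false → startsMatch (i ∷ j ∷ w) ≡ false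
startsMatch-desc i j []          e = refl
startsMatch-desc i j (k ∷ [])    e rewrite e = refl
startsMatch-desc i j (k ∷ l ∷ w) e rewrite e with i <ᵇ k in i<k | k <ᵇ j in k<j
... | false | _     = refl
... | true  | false = refl
... | true  | true  with trans (sym e) (<ᵇ-trans i k j i<k k<j)
... | ()

-- The reading states compute the polynomials `A`

-- The exponent is `des w`, not `1 + des w`, so that a new front letter contributes a factor y
-- exactly at a descent. The remaining y is the outer `shift` of `avoidWeight`.
weight : Word → Poly
weight w = if hasMatch Γ w then 0P else mono 1ℚ (des w)

weight-desc : ∀ {i j w} → Distinct (i ∷ j ∷ w) → (i <ᵇ j) ≡ false → weight (i ∷ j ∷ w) ≈ shift (weight (j ∷ w))
weight-desc {i} {j} {w} d@((i≢j ∷ _) ∷ _) e m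
  rewrite hasMatch-∷ d | startsMatch-desc i j w e | <ᵇ-flip i j i≢j | e with hasMatch Γ (j ∷ w) | m
... | true  | zero   = refl
... | true  | suc m′ = refl
... | false | zero   = refl
... | false | suc m′ = refl

weight-asc : ∀ {i j w} → Distinct (i ∷ j ∷ w) → (i <ᵇ j) ≡ true → startsMatch (i ∷ j ∷ w) ≡ false →
  weight (i ∷ j ∷ w) ≈ weight (j ∷ w)
weight-asc {i} {j} {w} d@((i≢j ∷ _) ∷ _) e s m
  rewrite hasMatch-∷ d | s | <ᵇ-flip i j i≢j | e = refl

weight-match : ∀ {i w} → Distinct (i ∷ w) → startsMatch (i ∷ w) ≡ true → weight (i ∷ w) ≈ 0P
weight-match d s m rewrite hasMatch-∷ d | s = refl

mono-zero : ∀ c → mono c 0 ≈ const c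
mono-zero c zero    = refl
mono-zero c (suc m) = refl

-- After i < j > k no match starts at j, and a match starting at i can only be a 1324, which the
-- next letter decides.
shift-α₃ : ∀ {i j k} w → Distinct (i ∷ j ∷ k ∷ w) → (i <ᵇ j) ≡ true → (j <ᵇ k) ≡ false →
  α₁ k w ≈ weight (k ∷ w) → shift (α₃ i j k w) ≈ weight (i ∷ j ∷ k ∷ w)
shift-α₃ {i} {j} {k} [] d@(_ ∷ d′) i<j j>k ih m = begin
  shift (α₁ k []) m          ≡⟨ shift-cong ih m ⟩
  shift (weight (k ∷ [])) m  ≡⟨ weight-desc d′ j>k m ⟨
  weight (j ∷ k ∷ []) m      ≡⟨ weight-asc d i<j (trans (cong (_∧ (j <ᵇ k)) i<j) j>k) m ⟨
  weight (i ∷ j ∷ k ∷ []) m  ∎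
shift-α₃ {i} {j} {k} (l ∷ w) d@(_ ∷ d′) i<j j>k ih m with matches1324 i j k l in match
... | true = trans (shift-0 m)
  (sym (weight-match d (cong₂ _∨_ (cong₂ _∧_ i<j j>k) match) m))
... | false = begin
  shift (α₁ k (l ∷ w)) m          ≡⟨ shift-cong ih m ⟩
  shift (weight (k ∷ l ∷ w)) m    ≡⟨ weight-desc d′ j>k m ⟨
  weight (j ∷ k ∷ l ∷ w) m        ≡⟨ weight-asc d i<j (cong₂ _∨_ (cong₂ _∧_ i<j j>k) match) m ⟨
  weight (i ∷ j ∷ k ∷ l ∷ w) m    ∎

α₁-weight : ∀ i w → Distinct (i ∷ w) → α₁ i w ≈ weight (i ∷ w)
α₂-weight : ∀ i j w → Distinct (i ∷ j ∷ w) → (i <ᵇ j) ≡ true → α₂ i j w ≈ weight (i ∷ j ∷ w)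

α₁-weight i []      d m = sym (mono-zero 1ℚ m)
α₁-weight i (j ∷ w) d@(_ ∷ d′) = if-≈ (i <ᵇ j) (α₂-weight i j w d)
  λ i>j m → trans (shift-cong (α₁-weight j w d′) m) (sym (weight-desc d i>j m))

α₂-weight i j [] d@(_ ∷ d′) i<j m = trans (sym (mono-zero 1ℚ m)) (sym (weight-asc d i<j refl m))
α₂-weight i j (k ∷ w) d@(_ ∷ _ ∷ d″) i<j = if-≈ (j <ᵇ k)
  (λ j<k m → sym (weight-match d (starts j<k w) m))
  (λ j>k → shift-α₃ w d i<j j>k (α₁-weight k w d″))
  where
  starts : (j <ᵇ k) ≡ true → ∀ w → startsMatch (i ∷ j ∷ k ∷ w) ≡ true
  starts j<k []      rewrite i<j | j<k = refl
  starts j<k (l ∷ w) rewrite i<j | j<k = refl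

insertions-Distinct : ∀ {x w} → All (x ≢_) w → Distinct w → All Distinct (insertions x w)
insertions-Distinct []          []         = ([] ∷ []) ∷ []
insertions-Distinct (x≢z ∷ x≢w) (z≢w ∷ dw) =
  ((x≢z ∷ x≢w) ∷ z≢w ∷ dw) ∷
  All.map⁺ (All.zipWith (λ (z≢v , dv) → z≢v ∷ dv)
    (insertions-All (λ z≡x → x≢z (sym z≡x)) z≢w , insertions-Distinct x≢w dw))

perms-Distinct : ∀ {xs} → Distinct xs → All Distinct (perms xs)
perms-Distinct []           = [] ∷ []
perms-Distinct (x≢xs ∷ dxs) = All.concat⁺ (All.map⁺
  (All.zipWith (λ (x≢w , dw) → insertions-Distinct x≢w dw) (perms-All x≢xs , perms-Distinct dxs)))

insertions-nonempty : ∀ x w → All (_≢ []) (insertions x w)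
insertions-nonempty x []      = (λ ()) ∷ []
insertions-nonempty x (z ∷ w) = (λ ()) ∷ All.map⁺ (All.universal (λ _ ()) (insertions x w))

avoidWeight-weight : ∀ w → w ≢ [] → Distinct w → avoidWeight w ≈ shift (weight w)
avoidWeight-weight []      w≢[] d = ⊥-elim (w≢[] refl)
avoidWeight-weight (i ∷ w) w≢[] d = shift-cong (α₁-weight i w d)

ℕtoℚ-+ : ∀ i j → ℕtoℚ (i + j) ≡ ℕtoℚ i +ℚ ℕtoℚ j
ℕtoℚ-+ i j = ℚ.toℚᵘ-injective (ℚᵘ.≃-trans (toℚᵘ-ℕtoℚ (i + j)) (ℚᵘ.≃-trans
  (*≡* (cong (ℤ._* (+ 1)) (cong₂ ℤ._+_ (sym (ℤ.*-identityʳ (+ i))) (sym (ℤ.*-identityʳ (+ j))))))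
  (ℚᵘ.≃-sym (ℚᵘ.≃-trans (ℚ.toℚᵘ-homo-+ (ℕtoℚ i) (ℕtoℚ j)) (ℚᵘ.+-cong (toℚᵘ-ℕtoℚ i) (toℚᵘ-ℕtoℚ j))))))
  where
  toℚᵘ-ℕtoℚ : ∀ k → toℚᵘ (ℕtoℚ k) ℚᵘ.≃ mkℚᵘ (+ k) 0
  toℚᵘ-ℕtoℚ k = ℚ.toℚᵘ-fromℚᵘ (mkℚᵘ (+ k) 0)

count-filter : ∀ (h : Word → Bool) m ws →
  ℕtoℚ (countᵇ (λ σ → suc (des σ) ≡ᵇ m) (filterᵇ (λ σ → not (h σ)) ws))
  ≡ Σ (λ w → shift (if h w then 0P else mono 1ℚ (des w))) ws m
count-filter h m []       = refl
count-filter h m (w ∷ ws) with h w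
... | true  = trans (count-filter h m ws) (trans (sym (ℚ.+-identityˡ rest)) (cong (_+ℚ rest) (sym (shift-0 m))))
  where rest = Σ (λ v → shift (if h v then 0P else mono 1ℚ (des v))) ws m
... | false = trans (ℕtoℚ-+ (if suc (des w) ≡ᵇ m then 1 else 0) _) (cong₂ _+ℚ_ (term m) (count-filter h m ws))
  where
  term : ∀ m → ℕtoℚ (if suc (des w) ≡ᵇ m then 1 else 0) ≡ shift (mono 1ℚ (des w)) m
  term zero    = refl
  term (suc m) with des w ≡ᵇ m
  ... | true  = refl
  ... | false = refl

A≈permSum : ∀ n → A Γ n ≈ permSum avoidWeight (map suc (upTo n))
A≈permSum zero    m = sym (ℚ.+-identityʳ _)
A≈permSum (suc n) m = trans (count-filter (hasMatch Γ) m (Sym (suc n))) (sym (Σ-congAll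
  (All.zipWith (λ (w≢[] , dw) → avoidWeight-weight _ w≢[] dw)
    -- The letter 1 is the head of the list that is permuted, so every word arises by inserting it.
    ( All.concat⁺ (All.map⁺ (All.universal (insertions-nonempty 1) (perms (map suc (applyUpTo suc n)))))
    , perms-Distinct (AllPairs.map <⇒≢ (suc-upTo-ascending (suc n))))) m))

-- The recursion for U

insertions-map : ∀ (φ : ℕ → ℕ) x w → insertions (φ x) (map φ w) ≡ map (map φ) (insertions x w)
insertions-map φ x []      = refl
insertions-map φ x (z ∷ w) = cong ((φ x ∷ φ z ∷ map φ w) ∷_) (begin
  map (φ z ∷_) (insertions (φ x) (map φ w))    ≡⟨ cong (map (φ z ∷_)) (insertions-map φ x w) ⟩
  map (φ z ∷_) (map (map φ) (insertions x w))  ≡⟨ map-∘ (insertions x w) ⟨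
  map (λ v → φ z ∷ map φ v) (insertions x w)   ≡⟨ map-∘ (insertions x w) ⟩
  map (map φ) (map (z ∷_) (insertions x w))    ∎)

perms-map : ∀ (φ : ℕ → ℕ) xs → perms (map φ xs) ≡ map (map φ) (perms xs)
perms-map φ []       = refl
perms-map φ (x ∷ xs) = begin
  concatMap (insertions (φ x)) (perms (map φ xs))            ≡⟨ cong (concatMap (insertions (φ x))) (perms-map φ xs) ⟩
  concatMap (insertions (φ x)) (map (map φ) (perms xs))      ≡⟨ concatMap-map (insertions (φ x)) (map φ) (perms xs) ⟩
  concatMap (λ w → insertions (φ x) (map φ w)) (perms xs)    ≡⟨ concatMap-cong (insertions-map φ x) (perms xs) ⟩
  concatMap (λ w → map (map φ) (insertions x w)) (perms xs)  ≡⟨ map-concatMap (map φ) (insertions x) (perms xs) ⟨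
  map (map φ) (concatMap (insertions x) (perms xs))          ∎

module _ (φ : ℕ → ℕ) (φ-<ᵇ : ∀ i j → (φ i <ᵇ φ j) ≡ (i <ᵇ j)) where

  α₁-map : ∀ p w → α₁ (φ p) (map φ w) ≈ α₁ p w
  α₂-map : ∀ p q w → α₂ (φ p) (φ q) (map φ w) ≈ α₂ p q w
  α₃-map : ∀ p q r w → α₁ (φ r) (map φ w) ≈ α₁ r w → α₃ (φ p) (φ q) (φ r) (map φ w) ≈ α₃ p q r w

  α₁-map p []      m = refl
  α₁-map p (q ∷ w) rewrite φ-<ᵇ p q with p <ᵇ q
  ... | true  = α₂-map p q w
  ... | false = shift-cong (α₁-map q w)

  α₂-map p q []      m = refl
  α₂-map p q (r ∷ w) rewrite φ-<ᵇ q r with q <ᵇ r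
  ... | true  = λ _ → refl
  ... | false = shift-cong (α₃-map p q r w (α₁-map r w))

  α₃-map p q r []      ih m = refl
  α₃-map p q r (t ∷ w) ih rewrite φ-<ᵇ p r | φ-<ᵇ r q | φ-<ᵇ q t with matches1324 p q r t
  ... | true  = λ _ → refl
  ... | false = ih

  avoidWeight-map : ∀ w → avoidWeight (map φ w) ≈ avoidWeight w
  avoidWeight-map []      m = refl
  avoidWeight-map (p ∷ w) = shift-cong (α₁-map p w)

  permSum-avoidWeight-map : ∀ xs → permSum avoidWeight (map φ xs) ≈ permSum avoidWeight xs
  permSum-avoidWeight-map xs m = begin
    Σ avoidWeight (perms (map φ xs)) m            ≡⟨ cong (λ ws → Σ avoidWeight ws m) (perms-map φ xs) ⟩
    Σ avoidWeight (map (map φ) (perms xs)) m      ≡⟨ Σ-map avoidWeight (map φ) (perms xs) m ⟩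
    Σ (λ w → avoidWeight (map φ w)) (perms xs) m  ≡⟨ Σ-cong avoidWeight-map (perms xs) m ⟩
    permSum avoidWeight xs m                      ∎

steps⇒< : ∀ {φ : ℕ → ℕ} → (∀ i → φ i < φ (suc i)) → ∀ {i j} → i < j → φ i < φ j
steps⇒< {φ} step {i} {suc j} (s≤s i≤j) with m≤n⇒m<n∨m≡n i≤j
... | inj₁ i<j  = <-trans (steps⇒< step i<j) (step j)
... | inj₂ refl = step i

steps⇒<ᵇ : ∀ {φ : ℕ → ℕ} → (∀ i → φ i < φ (suc i)) → ∀ i j → (φ i <ᵇ φ j) ≡ (i <ᵇ j)
steps⇒<ᵇ {φ} step i j with <-cmp i j
... | tri< i<j _ _  = trans (<ᵇ-true (steps⇒< step i<j)) (sym (<ᵇ-true i<j))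
... | tri≈ _ refl _ = trans (<ᵇ-irrefl (φ i)) (sym (<ᵇ-irrefl i))
... | tri> _ _ j<i  = trans (<ᵇ-false (<⇒≤ (steps⇒< step j<i))) (sym (<ᵇ-false (<⇒≤ j<i)))

-- Relabelling asks for a map increasing on all of ℕ, so the list is prolonged by consecutive
-- numbers beyond its end. The bound `c` on φ 0 lets the next letter be put in front.
ascending-applyUpTo : ∀ c {xs} → All (c ≤_) xs → AllPairs _<_ xs →
  ∃ λ φ → (∀ i → φ i < φ (suc i)) × c ≤ φ 0 × xs ≡ applyUpTo φ (length xs)
ascending-applyUpTo c [] [] = (λ i → c + i) , (λ i → +-monoʳ-< c (n<1+n i)) , m≤m+n c 0 , refl
ascending-applyUpTo c {x ∷ xs} (c≤x ∷ _) (x<xs ∷ asc) =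
  let φ , step , x<φ0 , eq = ascending-applyUpTo (suc x) x<xs asc
  in (λ { zero → x ; (suc i) → φ i }) , (λ { zero → x<φ0 ; (suc i) → step i }) , c≤x , cong (x ∷_) eq

-- The weight depends only on comparisons of letters, so `xs` and 1, ..., n may both be relabelled
-- from `upTo n`.
permSum-avoidWeight : ∀ {xs} → AllPairs _<_ xs → permSum avoidWeight xs ≈ A Γ (length xs)
permSum-avoidWeight {xs} asc m with ascending-applyUpTo 0 (All.universal (λ _ → z≤n) xs) asc
... | φ , step , _ , eq = begin
  permSum avoidWeight xs m                        ≡⟨ cong (λ ys → permSum avoidWeight ys m) (trans eq (sym (map-upTo φ n))) ⟩
  permSum avoidWeight (map φ (upTo n)) m          ≡⟨ permSum-avoidWeight-map φ (steps⇒<ᵇ step) (upTo n) m ⟩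
  permSum avoidWeight (upTo n) m                  ≡⟨ permSum-avoidWeight-map suc (λ _ _ → refl) (upTo n) m ⟨
  permSum avoidWeight (map suc (upTo n)) m        ≡⟨ A≈permSum n m ⟨
  A Γ n m                                         ∎
  where n = length xs

AllPairs-resp-⊆ : ∀ {R : ℕ → ℕ → Set} {xs ys} → xs ⊆ ys → AllPairs R ys → AllPairs R xs
AllPairs-resp-⊆ []         []         = []
AllPairs-resp-⊆ (y ∷ʳ τ)   (_ ∷ rys)  = AllPairs-resp-⊆ τ rys
AllPairs-resp-⊆ (refl ∷ τ) (ry ∷ rys) = All-resp-⊆ τ ry ∷ AllPairs-resp-⊆ τ rys

-- The cancellation on single nonempty words, summed over all words on n + 1 letters: a
-- positive-degree coefficient of the product of the two series vanishes.
splitSum-A-ballot : ∀ n → splitSum (λ i j → A Γ i ⊗ ballot j 0) (suc n) ≈ 0P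
splitSum-A-ballot n m = begin
  splitSum H (suc n) m
    ≡⟨ cong (λ k → splitSum H k m) (trans (sym (length-upTo (suc n))) (sym (length-map suc (upTo (suc n))))) ⟩
  splitSum H (length xs) m
    ≡⟨ permSum-conv avoidWeight brickWeight (A Γ) (λ j → ballot j 0) xs
         (λ ys τ → permSum-avoidWeight (AllPairs-resp-⊆ τ asc))
         (λ ys τ → permSum-brickWeight (All-resp-⊆ τ pos) (AllPairs-resp-⊆ τ asc)) m ⟨
  permSum (conv avoidWeight brickWeight) xs m
    ≡⟨ Σ-congAll (All.map zero-on (All.concat⁺ (All.map⁺
         (All.universal (insertions-nonempty 1) (perms (map suc (applyUpTo suc n))))))) m ⟩
  Σ (λ _ → 0P) (perms xs) m
    ≡⟨ Σ-zero (perms xs) m ⟩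
  0ℚ ∎
  where
  H = λ i j → A Γ i ⊗ ballot j 0
  xs = map suc (upTo (suc n))
  asc = suc-upTo-ascending (suc n)
  pos : All (0 <_) xs
  pos = All.map⁺ (All.universal (λ _ → z<s) (upTo (suc n)))
  zero-on : ∀ {w} → w ≢ [] → conv avoidWeight brickWeight w ≈ 0P
  zero-on {[]}    w≢[] = ⊥-elim (w≢[] refl)
  zero-on {p ∷ w} _    = conv-avoid-brick p w

-- The part of the binomial convolution from index i on, with l more terms to come; it runs upward
-- in i to match the shape of `convTail`.
binomialSum : ℕ → (ℕ → ℕ → Poly) → ℕ → ℕ → Poly
binomialSum n H i zero    = scale (ℕtoℚ (n C i)) (H i 0)
binomialSum n H i (suc l) = scale (ℕtoℚ (n C i)) (H i (suc l)) ⊕ binomialSum n H (suc i) l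

scale-0 : ∀ {k} p → k ≡ 0 → scale (ℕtoℚ k) p ≈ 0P
scale-0 p refl m = ℚ.*-zeroˡ (p m)

-- The right side has one more term, and its coefficient is C(n, n + 1) = 0.
binomialSum-suc : ∀ n H i l → i + l ≡ n → binomialSum n (λ i j → H i (suc j)) i l ≈ binomialSum n H i (suc l)
binomialSum-suc n H i zero eq m = trans (sym (ℚ.+-identityʳ _))
  (cong (scale (ℕtoℚ (n C i)) (H i 1) m +ℚ_)
    (sym (scale-0 (H (suc i) 0) (k>n⇒nCk≡0 (s≤s (≤-reflexive (trans (sym eq) (+-identityʳ i))))) m)))
binomialSum-suc n H i (suc l) eq m = cong (scale (ℕtoℚ (n C i)) (H i (suc (suc l))) m +ℚ_)
  (binomialSum-suc n H (suc i) l (trans (sym (+-suc i l)) eq) m)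

scale-pascal : ∀ n i p → scale (ℕtoℚ (suc n C suc i)) p ≈ (scale (ℕtoℚ (n C i)) p ⊕ scale (ℕtoℚ (n C suc i)) p)
scale-pascal n i p m = begin
  ℕtoℚ (suc n C suc i) *ℚ p m                       ≡⟨ cong (λ k → ℕtoℚ k *ℚ p m) (nCk+nC[k+1]≡[n+1]C[k+1] n i) ⟨
  ℕtoℚ (n C i + n C suc i) *ℚ p m                   ≡⟨ cong (_*ℚ p m) (ℕtoℚ-+ (n C i) (n C suc i)) ⟩
  (ℕtoℚ (n C i) +ℚ ℕtoℚ (n C suc i)) *ℚ p m         ≡⟨ ℚ.*-distribʳ-+ (p m) (ℕtoℚ (n C i)) (ℕtoℚ (n C suc i)) ⟩
  ℕtoℚ (n C i) *ℚ p m +ℚ ℕtoℚ (n C suc i) *ℚ p m    ∎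

binomialSum-pascal : ∀ n H i l → binomialSum (suc n) H (suc i) l ≈
  (binomialSum n (λ i j → H (suc i) j) i l ⊕ binomialSum n H (suc i) l)
binomialSum-pascal n H i zero    m = scale-pascal n i (H (suc i) 0) m
binomialSum-pascal n H i (suc l) m = trans
  (cong₂ _+ℚ_ (scale-pascal n i (H (suc i) (suc l)) m) (binomialSum-pascal n H (suc i) l m))
  (+-interchange (scale (ℕtoℚ (n C i)) (H (suc i) (suc l)) m) (scale (ℕtoℚ (n C suc i)) (H (suc i) (suc l)) m)
    (binomialSum n (λ i j → H (suc i) j) (suc i) l m) (binomialSum n H (suc (suc i)) l m))

splitSum≈binomialSum : ∀ n H → splitSum H n ≈ binomialSum n H 0 n
splitSum≈binomialSum zero    H m = sym (ℚ.*-identityˡ (H 0 0 m))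
splitSum≈binomialSum (suc n) H m = begin
  splitSum (λ i j → H (suc i) j) n m +ℚ splitSum (λ i j → H i (suc j)) n m
    ≡⟨ cong₂ _+ℚ_ (splitSum≈binomialSum n (λ i j → H (suc i) j) m)
         (trans (splitSum≈binomialSum n (λ i j → H i (suc j)) m) (binomialSum-suc n H 0 n refl m)) ⟩
  b +ℚ (h +ℚ c)
    ≡⟨ solve 3 (λ b h c → b :+ (h :+ c) := h :+ (b :+ c)) refl b h c ⟩
  h +ℚ (b +ℚ c)
    ≡⟨ cong (h +ℚ_) (binomialSum-pascal n H 0 n m) ⟨
  binomialSum (suc n) H 0 (suc n) m ∎
  where
  b = binomialSum n (λ i j → H (suc i) j) 0 n m
  h = scale (ℕtoℚ 1) (H 0 (suc n)) m
  c = binomialSum n H 1 n m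

data Lists (F : ℕ → Poly) : ℕ → List Poly → Set where
  []  : ∀ {u} → u ≈ F 0 → Lists F 0 (u ∷ [])
  _∷_ : ∀ {n u us} → u ≈ F (suc n) → Lists F n us → Lists F (suc n) (u ∷ us)

convTail≈binomialSum : ∀ n i {F l us} → Lists F l us → convTail Γ n i us ≈ binomialSum n (λ i j → A Γ i ⊗ F j) (suc i) l
convTail≈binomialSum n i ([] {u} u≈) m = trans (cong₂ _+ℚ_
  (cong (ℕtoℚ (n C suc i) *ℚ_) (⊗-congˡ (A Γ (suc i)) u≈ m)) (const-0 m)) (ℚ.+-identityʳ _)
  where
  const-0 : const 0ℚ ≈ 0P
  const-0 zero    = refl
  const-0 (suc m) = refl
convTail≈binomialSum n i (u≈ ∷ us≈) m = cong₂ _+ℚ_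
  (cong (ℕtoℚ (n C suc i) *ℚ_) (⊗-congˡ (A Γ (suc i)) u≈ m)) (convTail≈binomialSum n (suc i) us≈ m)

-- Since A₀ = 1, the vanishing convolution can be solved for its term of index 0, which gives the
-- recursion that defines `Us`.
Us-ballot : ∀ n → Lists (λ j → ballot j 0) n (Us Γ n)
Us-ballot zero    = [] (λ _ → refl)
Us-ballot (suc n) = (λ m → begin
  -ℚ convTail Γ (suc n) 0 (Us Γ n) m
    ≡⟨ cong -ℚ_ (convTail≈binomialSum (suc n) 0 (Us-ballot n) m) ⟩
  -ℚ tail m
    ≡⟨ solve 2 (λ b t → :- t := b :+ :- (b :+ t)) refl (ballot (suc n) 0 m) (tail m) ⟩
  ballot (suc n) 0 m +ℚ -ℚ (ballot (suc n) 0 m +ℚ tail m)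
    ≡⟨ cong (λ s → ballot (suc n) 0 m +ℚ -ℚ s) (total m) ⟩
  ballot (suc n) 0 m +ℚ 0ℚ
    ≡⟨ ℚ.+-identityʳ _ ⟩
  ballot (suc n) 0 m ∎) ∷ Us-ballot n
  where
  H = λ i j → A Γ i ⊗ ballot j 0
  tail = binomialSum (suc n) H 1 n
  total : (ballot (suc n) 0 ⊕ tail) ≈ 0P
  total m = begin
    ballot (suc n) 0 m +ℚ tail m
      ≡⟨ cong (_+ℚ tail m) (trans (ℚ.*-identityˡ _) (⊗-identityˡ (ballot (suc n) 0) m)) ⟨
    binomialSum (suc n) H 0 (suc n) m
      ≡⟨ splitSum≈binomialSum (suc n) H m ⟨
    splitSum H (suc n) m
      ≡⟨ splitSum-A-ballot n m ⟩
    0ℚ ∎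

U≈ballot : ∀ n → U Γ n ≈ ballot n 0
U≈ballot n with Us Γ n | Us-ballot n
... | _ | [] u≈    = u≈
... | _ | u≈ ∷ us≈ = u≈

-- Ballot numbers

-- paths h u d counts the paths of ballot from height h with u up and d down steps.
paths : ℕ → ℕ → ℕ → ℕ
paths h       zero    zero    = 1
paths zero    zero    (suc d) = 0
paths (suc h) zero    (suc d) = paths h zero d
paths zero    (suc u) d       = paths 1 u d
paths (suc h) (suc u) zero    = paths (suc (suc h)) u zero
paths (suc h) (suc u) (suc d) = paths (suc (suc h)) u (suc d) + paths h (suc u) d

ballot-high : ∀ {n m} h → n < m → ballot n h m ≡ 0ℚ
ballot-high {zero}  {suc m} h       n<m       = refl
ballot-high {suc n} {suc m} zero    (s≤s n<m) = cong -ℚ_ (ballot-high 1 n<m)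
ballot-high {suc n} {suc m} (suc h) (s≤s n<m) =
  cong₂ (λ p q → -ℚ p +ℚ q) (ballot-high (suc (suc h)) n<m) (ballot-high h (m<n⇒m<1+n n<m))

ballot-paths : ∀ n h u d → n ≡ u + d → ballot n h u ≡ sgn u *ℚ ℕtoℚ (paths h u d)
ballot-paths zero    h       zero    zero    eq   = refl
ballot-paths (suc n) zero    zero    (suc d) eq   = refl
ballot-paths (suc n) (suc h) zero    (suc d) refl = trans (ℚ.+-identityˡ _) (ballot-paths n h zero d refl)
ballot-paths (suc n) zero    (suc u) d       eq   = trans (cong -ℚ_ (ballot-paths n 1 u d (suc-injective eq)))
  (ℚ.neg-distribˡ-* (sgn u) (ℕtoℚ (paths 1 u d)))
ballot-paths (suc n) (suc h) (suc u) zero    eq   = begin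
  -ℚ ballot n (suc (suc h)) u +ℚ ballot n h (suc u)
    ≡⟨ cong₂ (λ p q → -ℚ p +ℚ q) (ballot-paths n (suc (suc h)) u 0 (suc-injective eq))
         -- With d = 0 only u steps remain, too few for u + 1 up steps.
         (ballot-high h (s≤s (≤-reflexive (trans (suc-injective eq) (+-identityʳ u))))) ⟩
  -ℚ (sgn u *ℚ ℕtoℚ (paths (suc (suc h)) u 0)) +ℚ 0ℚ
    ≡⟨ solve 2 (λ s p → :- (s :* p) :+ con 0ℚ := (:- s) :* p) refl (sgn u) (ℕtoℚ (paths (suc (suc h)) u 0)) ⟩
  -ℚ sgn u *ℚ ℕtoℚ (paths (suc (suc h)) u 0) ∎
ballot-paths (suc n) (suc h) (suc u) (suc d) eq   = begin
  -ℚ ballot n (suc (suc h)) u +ℚ ballot n h (suc u)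
    ≡⟨ cong₂ (λ p q → -ℚ p +ℚ q) (ballot-paths n (suc (suc h)) u (suc d) (suc-injective eq))
         (ballot-paths n h (suc u) d (trans (suc-injective eq) (+-suc u d))) ⟩
  -ℚ (sgn u *ℚ ℕtoℚ i) +ℚ (-ℚ sgn u *ℚ ℕtoℚ j)
    ≡⟨ solve 3 (λ s p q → :- (s :* p) :+ (:- s) :* q := (:- s) :* (p :+ q)) refl (sgn u) (ℕtoℚ i) (ℕtoℚ j) ⟩
  -ℚ sgn u *ℚ (ℕtoℚ i +ℚ ℕtoℚ j)
    ≡⟨ cong (-ℚ sgn u *ℚ_) (ℕtoℚ-+ i j) ⟨
  -ℚ sgn u *ℚ ℕtoℚ (i + j) ∎
  where
  i = paths (suc (suc h)) u (suc d)
  j = paths h (suc u) d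

paths-below : ∀ h u d → h + u < d → paths h u d ≡ 0
paths-below h       zero    zero    lt       = ⊥-elim (n≮0 lt)
paths-below zero    zero    (suc d) lt       = refl
paths-below (suc h) zero    (suc d) (s≤s lt) = paths-below h zero d lt
paths-below zero    (suc u) d       lt       = paths-below 1 u d lt
paths-below (suc h) (suc u) zero    lt       = ⊥-elim (n≮0 lt)
paths-below (suc h) (suc u) (suc d) lt       = cong₂ _+_
  (paths-below (suc (suc h)) u (suc d) (subst (λ k → suc k < suc d) (+-suc h u) lt))
  (paths-below h (suc u) d (s≤s⁻¹ lt))

-- reflected n d h = C(n, d − h − 1), read as 0 when d ≤ h.
reflected : ℕ → ℕ → ℕ → ℕ
reflected n zero    h       = 0
reflected n (suc d) zero    = n C d
reflected n (suc d) (suc h) = reflected n d h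

reflected-≤ : ∀ n d h → d ≤ h → reflected n d h ≡ 0
reflected-≤ n zero    h       d≤h       = refl
reflected-≤ n (suc d) (suc h) (s≤s d≤h) = reflected-≤ n d h d≤h

reflected-pascal : ∀ n d h → reflected (suc n) d h ≡ reflected n d (suc h) + reflected n d h
reflected-pascal n zero          h       = refl
reflected-pascal n (suc zero)    zero    = refl
reflected-pascal n (suc (suc d)) zero    = sym (nCk+nC[k+1]≡[n+1]C[k+1] n d)
reflected-pascal n (suc d)       (suc h) = reflected-pascal n d h

-- Reflection at height -1, proved by removing the first step: both sides obey Pascal's rule. The
-- hypothesis says that the final height h + u - d is at least -1, and no step changes that number.
paths-reflection : ∀ n h u d → n ≡ u + d → d ≤ suc (h + u) → paths h u d + reflected n d h ≡ n C d
paths-reflection n h zero zero eq le = refl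
paths-reflection (suc n) zero zero (suc zero) refl le = refl
paths-reflection (suc n) zero zero (suc (suc d)) eq (s≤s ())
paths-reflection (suc n) (suc h) zero (suc d) refl (s≤s le) = begin
  paths h 0 d + reflected (suc d) d h
    ≡⟨ cong (λ r → paths h 0 d + r) (reflected-pascal d d h) ⟩
  paths h 0 d + (reflected d d (suc h) + reflected d d h)
    ≡⟨ cong (λ r → paths h 0 d + (r + reflected d d h)) (reflected-≤ d d (suc h) (≤-trans le (s≤s (≤-reflexive (+-identityʳ h))))) ⟩
  paths h 0 d + reflected d d h
    ≡⟨ paths-reflection d h 0 d refl le ⟩
  d C d
    ≡⟨ trans (nCn≡1 d) (sym (nCn≡1 (suc d))) ⟩
  suc d C suc d ∎
paths-reflection (suc n) zero (suc u) zero eq le = paths-reflection n 1 u zero (suc-injective eq) z≤n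
paths-reflection (suc n) zero (suc u) (suc d) eq le = begin
  paths 1 u (suc d) + suc n C d
    -- At height 0 the step must go up; the `n C d` sequences that begin with a down step all belong
    -- to the reflected ones.
    ≡⟨ cong (λ r → paths 1 u (suc d) + r) (reflected-pascal n (suc d) 0) ⟩
  paths 1 u (suc d) + (reflected n d 0 + n C d)
    ≡⟨ +-assoc (paths 1 u (suc d)) (reflected n d 0) (n C d) ⟨
  (paths 1 u (suc d) + reflected n d 0) + n C d
    ≡⟨ cong (_+ n C d) (paths-reflection n 1 u (suc d) (suc-injective eq) le) ⟩
  n C suc d + n C d
    ≡⟨ +-comm (n C suc d) (n C d) ⟩
  n C d + n C suc d
    ≡⟨ nCk+nC[k+1]≡[n+1]C[k+1] n d ⟩
  suc n C suc d ∎
paths-reflection (suc n) (suc h) (suc u) zero eq le = paths-reflection n (suc (suc h)) u zero (suc-injective eq) z≤n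
paths-reflection (suc n) (suc h) (suc u) (suc d) eq (s≤s le) = begin
  (i + j) + reflected (suc n) d h
    ≡⟨ cong (λ r → (i + j) + r) (reflected-pascal n d h) ⟩
  (i + j) + (r + s)
    ≡⟨ ℕS.solve 4 (λ i j r s → (i ℕS.:+ j) ℕS.:+ (r ℕS.:+ s) ℕS.:= (j ℕS.:+ s) ℕS.:+ (i ℕS.:+ r)) refl i j r s ⟩
  (j + s) + (i + r)
    ≡⟨ cong₂ _+_ (paths-reflection n h (suc u) d (trans (suc-injective eq) (+-suc u d)) le)
         (paths-reflection n (suc (suc h)) u (suc d) (suc-injective eq)
           (s≤s (subst (λ k → d ≤ suc k) (+-suc h u) le))) ⟩
  n C d + n C suc d
    ≡⟨ nCk+nC[k+1]≡[n+1]C[k+1] n d ⟩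
  suc n C suc d ∎
  where
  i = paths (suc (suc h)) u (suc d)
  j = paths h (suc u) d
  r = reflected n d (suc h)
  s = reflected n d h

-- This is (k + 1) C(n, k + 1) = (n - k) C(n, k), freed of subtraction.
C-absorption : ∀ n k → suc k * (n C suc k) + k * (n C k) ≡ n * (n C k)
C-absorption zero    zero    = refl
C-absorption zero    (suc k) = trans (cong₂ _+_
  (cong (suc (suc k) *_) (k>n⇒nCk≡0 {0} {suc (suc k)} z<s)) (cong (suc k *_) (k>n⇒nCk≡0 {0} {suc k} z<s)))
  (cong₂ _+_ (*-zeroʳ (suc (suc k))) (*-zeroʳ (suc k)))
C-absorption (suc n) zero    = trans (+-identityʳ _) (trans (+-identityʳ _) (trans (nC1≡n (suc n)) (sym (*-identityʳ (suc n)))))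
C-absorption (suc n) (suc k) = begin
  suc (suc k) * (suc n C suc (suc k)) + suc k * (suc n C suc k)
    ≡⟨ cong₂ (λ p q → suc (suc k) * p + suc k * q) (sym (nCk+nC[k+1]≡[n+1]C[k+1] n (suc k))) (sym (nCk+nC[k+1]≡[n+1]C[k+1] n k)) ⟩
  suc (suc k) * (y + z) + suc k * (x + y)
    ≡⟨ ℕS.solve 4 (λ k x y z →
         (ℕS.con 2 ℕS.:+ k) ℕS.:* (y ℕS.:+ z) ℕS.:+ (ℕS.con 1 ℕS.:+ k) ℕS.:* (x ℕS.:+ y) ℕS.:=
         (((ℕS.con 2 ℕS.:+ k) ℕS.:* z ℕS.:+ (ℕS.con 1 ℕS.:+ k) ℕS.:* y) ℕS.:+ ((ℕS.con 1 ℕS.:+ k) ℕS.:* y ℕS.:+ k ℕS.:* x))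
           ℕS.:+ (x ℕS.:+ y)) refl k x y z ⟩
  ((suc (suc k) * z + suc k * y) + (suc k * y + k * x)) + (x + y)
    ≡⟨ cong (_+ (x + y)) (cong₂ _+_ (C-absorption n (suc k)) (C-absorption n k)) ⟩
  (n * y + n * x) + (x + y)
    ≡⟨ ℕS.solve 3 (λ n x y → (n ℕS.:* y ℕS.:+ n ℕS.:* x) ℕS.:+ (x ℕS.:+ y) ℕS.:= (ℕS.con 1 ℕS.:+ n) ℕS.:* (x ℕS.:+ y)) refl n x y ⟩
  suc n * (x + y)
    ≡⟨ cong (suc n *_) (nCk+nC[k+1]≡[n+1]C[k+1] n k) ⟩
  suc n * (suc n C suc k) ∎
  where
  x = n C k
  y = n C suc k
  z = n C suc (suc k)

-- The ballot theorem without division; `e` is the final height. For d > 0 reflection gives C(n, d)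
-- - C(n, d - 1), and d C(n, d) = (u + 1) C(n, d - 1) by absorption.
paths-ballot : ∀ n u d e → n ≡ u + d → u ≡ d + e → suc u * paths 0 u d ≡ suc e * (n C d)
paths-ballot n u zero e eq refl = cong (suc e *_) (trans (sym (+-identityʳ _)) (paths-reflection n 0 u 0 eq z≤n))
paths-ballot n u (suc d) e eq u≡ = +-cancelʳ-≡ (suc u * (n C d)) _ _ (begin
  suc u * p + suc u * (n C d)
    ≡⟨ *-distribˡ-+ (suc u) p (n C d) ⟨
  suc u * (p + n C d)
    ≡⟨ cong (suc u *_) (paths-reflection n 0 u (suc d) eq (≤-trans (subst (suc d ≤_) (sym u≡) (m≤m+n (suc d) e)) (n≤1+n u))) ⟩
  suc u * (n C suc d)
    ≡⟨ cong (λ k → suc k * (n C suc d)) u≡ ⟩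
  suc (suc d + e) * (n C suc d)
    ≡⟨ ℕS.solve 3 (λ d e c → (ℕS.con 1 ℕS.:+ ((ℕS.con 1 ℕS.:+ d) ℕS.:+ e)) ℕS.:* c ℕS.:=
         (ℕS.con 1 ℕS.:+ e) ℕS.:* c ℕS.:+ (ℕS.con 1 ℕS.:+ d) ℕS.:* c) refl d e (n C suc d) ⟩
  suc e * (n C suc d) + suc d * (n C suc d)
    ≡⟨ cong (λ r → suc e * (n C suc d) + r) absorb ⟩
  suc e * (n C suc d) + suc u * (n C d) ∎)
  where
  p = paths 0 u (suc d)
  absorb : suc d * (n C suc d) ≡ suc u * (n C d)
  absorb = +-cancelʳ-≡ (d * (n C d)) _ _ (begin
    suc d * (n C suc d) + d * (n C d)  ≡⟨ C-absorption n d ⟩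
    n * (n C d)                        ≡⟨ cong (_* (n C d)) (trans eq (+-suc u d)) ⟩
    (suc u + d) * (n C d)              ≡⟨ *-distribʳ-+ (n C d) (suc u) d ⟩
    suc u * (n C d) + d * (n C d)      ∎)

-- The coefficients of U

ℕtoℚ≡/ : ∀ k x d → suc d * k ≡ x → ℕtoℚ k ≡ (+ x) / suc d
ℕtoℚ≡/ k x d eq = ℚ.fromℚᵘ-cong {mkℚᵘ (+ k) 0} {mkℚᵘ (+ x) d} (*≡* (begin
  + k ℤ.* + suc d  ≡⟨ ℤ.pos-* k (suc d) ⟨
  + (k * suc d)    ≡⟨ cong +_ (trans (*-comm k (suc d)) eq) ⟩
  + x              ≡⟨ ℤ.*-identityʳ (+ x) ⟨
  + x ℤ.* + 1      ∎))

U-coeff : ∀ n u d e → n ≡ u + d → u ≡ d + e → U Γ n u ≡ sgn u *ℚ ((+ (suc e * (n C d))) / suc u)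
U-coeff n u d e n≡ u≡ = trans (U≈ballot n u) (trans (ballot-paths n 0 u d n≡)
  (cong (sgn u *ℚ_) (ℕtoℚ≡/ (paths 0 u d) _ u (paths-ballot n u d e n≡ u≡))))

U-low : ∀ n m → m + m < n → U Γ n m ≡ 0ℚ
U-low n m lt = begin
  U Γ n m                                ≡⟨ U≈ballot n m ⟩
  ballot n 0 m                           ≡⟨ ballot-paths n 0 m (n ∸ m) (sym (m+[n∸m]≡n (≤-trans (m≤m+n m m) (<⇒≤ lt)))) ⟩
  sgn m *ℚ ℕtoℚ (paths 0 m (n ∸ m))      ≡⟨ cong (λ k → sgn m *ℚ ℕtoℚ k) (paths-below 0 m (n ∸ m) (m+n≤o⇒m≤o∸n (suc m) lt)) ⟩
  sgn m *ℚ 0ℚ                            ≡⟨ ℚ.*-zeroʳ (sgn m) ⟩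
  0ℚ                                     ∎

U-high : ∀ n m → n < m → U Γ n m ≡ 0ℚ
U-high n m n<m = trans (U≈ballot n m) (ballot-high 0 n<m)

sumTo-single : ∀ n (f : ℕ → ℚ) k → k ≤ n → (∀ i → i ≢ k → f i ≡ 0ℚ) → sumTo n f ≡ f k
sumTo-single zero    f zero k≤n f≡0 = refl
sumTo-single (suc n) f k k≤n f≡0 with m≤n⇒m<n∨m≡n k≤n
... | inj₁ (s≤s k≤n′) = trans (cong₂ _+ℚ_ (sumTo-single n f k k≤n′ f≡0) (f≡0 (suc n) (λ { refl → 1+n≰n k≤n′ })))
                              (ℚ.+-identityʳ (f k))
... | inj₂ refl = trans (cong (_+ℚ f (suc n)) (sumTo-vanish n f λ i i≤n → f≡0 i (λ { refl → 1+n≰n i≤n })))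
                        (ℚ.+-identityˡ (f (suc n)))

≡ᵇ-refl : ∀ m → (m ≡ᵇ m) ≡ true
≡ᵇ-refl zero    = refl
≡ᵇ-refl (suc m) = ≡ᵇ-refl m

≢⇒≡ᵇ-false : ∀ {m n} → m ≢ n → (m ≡ᵇ n) ≡ false
≢⇒≡ᵇ-false {zero}  {zero}  m≢n = ⊥-elim (m≢n refl)
≢⇒≡ᵇ-false {zero}  {suc n} m≢n = refl
≢⇒≡ᵇ-false {suc m} {zero}  m≢n = refl
≢⇒≡ᵇ-false {suc m} {suc n} m≢n = ≢⇒≡ᵇ-false (λ m≡n → m≢n (cong suc m≡n))

mono-≢ : ∀ c {e m} → e ≢ m → mono c e m ≡ 0ℚ
mono-≢ c e≢m rewrite ≢⇒≡ᵇ-false e≢m = refl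

mono-≡ : ∀ c e → mono c e e ≡ c
mono-≡ c e rewrite ≡ᵇ-refl e = refl

-- The exponents s, ..., s + n occur once each, so a coefficient lies below, above or inside this
-- window. The function `e` allows the exponent to be written as `n + k + 1` when s is `suc n`.
psum-mono : ∀ n s (p : Poly) (c : ℕ → ℚ) (e : ℕ → ℕ) → (∀ k → e k ≡ s + k) →
  (∀ m → m < s → p m ≡ 0ℚ) → (∀ m → s + n < m → p m ≡ 0ℚ) → (∀ k → k ≤ n → p (e k) ≡ c k) →
  p ≈ psum n (λ k → mono (c k) (e k))
psum-mono n s p c e e≡ low high coeff m with m <? s | s + n <? m
... | yes m<s | _ = trans (low m m<s) (sym (sumTo-vanish n _ λ k _ → mono-≢ (c k)
  λ e≡m → <⇒≱ m<s (subst (s ≤_) (trans (sym (e≡ k)) e≡m) (m≤m+n s k))))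
... | no _ | yes m>s+n = trans (high m m>s+n) (sym (sumTo-vanish n _ λ k k≤n → mono-≢ (c k)
  λ e≡m → <⇒≱ m>s+n (subst (_≤ s + n) (trans (sym (e≡ k)) e≡m) (+-monoʳ-≤ s k≤n))))
... | no m≮s | no m≯s+n = begin
  p m                                          ≡⟨ cong p ek≡m ⟨
  p (e k)                                      ≡⟨ coeff k k≤n ⟩
  c k                                          ≡⟨ mono-≡ (c k) (e k) ⟨
  mono (c k) (e k) (e k)                       ≡⟨ sumTo-single n (λ i → mono (c i) (e i) (e k)) k k≤n
                                                    (λ i i≢k → mono-≢ (c i) λ ei≡ek → i≢k (+-cancelˡ-≡ s i k
                                                      (trans (sym (e≡ i)) (trans ei≡ek (e≡ k))))) ⟨
  psum n (λ i → mono (c i) (e i)) (e k)        ≡⟨ cong (psum n (λ i → mono (c i) (e i))) ek≡m ⟩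
  psum n (λ i → mono (c i) (e i)) m            ∎
  where
  k = m ∸ s
  s+k≡m : s + k ≡ m
  s+k≡m = m+[n∸m]≡n (≮⇒≥ m≮s)
  ek≡m : e k ≡ m
  ek≡m = trans (e≡ k) s+k≡m
  k≤n : k ≤ n
  k≤n = +-cancelˡ-≤ s k n (subst (_≤ s + n) (sym s+k≡m) (≮⇒≥ m≯s+n))

theorem7 : (n m : ℕ) →
    (U Γ (2 * n) m
    ≡ psum n (λ k → mono (sgn (n + k) *ℚ ((+ ((2 * k + 1) * ((2 * n) C (n ∸ k)))) / suc (n + k))) (n + k)) m)
    × (U Γ (2 * n + 1) m
    ≡ psum n (λ k → mono (sgn (n + k + 1) *ℚ ((+ (2 * (k + 1) * ((2 * n + 1) C (n ∸ k)))) / suc (n + k + 1))) (n + k + 1)) m)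
theorem7 n m = even m , odd m
  where
  2n≡n+n : 2 * n ≡ n + n
  2n≡n+n = cong (λ x → n + x) (+-identityʳ n)

  split : ∀ {k} → k ≤ n → (n + k) + (n ∸ k) ≡ 2 * n
  split {k} k≤n = begin
    (n + k) + (n ∸ k)   ≡⟨ +-assoc n k (n ∸ k) ⟩
    n + (k + (n ∸ k))   ≡⟨ cong (λ x → n + x) (m+[n∸m]≡n k≤n) ⟩
    n + n               ≡⟨ 2n≡n+n ⟨
    2 * n               ∎

  excess : ∀ {k} → k ≤ n → n + k ≡ (n ∸ k) + 2 * k
  excess {k} k≤n = begin
    n + k               ≡⟨ cong (_+ k) (m∸n+n≡m k≤n) ⟨
    (n ∸ k) + k + k     ≡⟨ ℕS.solve 2 (λ x k → x ℕS.:+ k ℕS.:+ k ℕS.:= x ℕS.:+ ℕS.con 2 ℕS.:* k) refl (n ∸ k) k ⟩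
    (n ∸ k) + 2 * k     ∎

  even : U Γ (2 * n) ≈ psum n (λ k → mono (sgn (n + k) *ℚ ((+ ((2 * k + 1) * ((2 * n) C (n ∸ k)))) / suc (n + k))) (n + k))
  -- To end at height at least 0, at least n of the 2n steps go up. With n + k up steps the final
  -- height is 2k, whence the factor 2k + 1.
  even = psum-mono n n (U Γ (2 * n)) _ (λ k → n + k) (λ _ → refl)
    (λ i i<n → U-low (2 * n) i (subst (i + i <_) (sym 2n≡n+n) (+-mono-< i<n i<n)))
    (λ i n+n<i → U-high (2 * n) i (subst (_< i) (sym 2n≡n+n) n+n<i))
    (λ k k≤n → trans (U-coeff (2 * n) (n + k) (n ∸ k) (2 * k) (sym (split k≤n)) (excess k≤n))
      (cong (λ x → sgn (n + k) *ℚ ((+ (x * ((2 * n) C (n ∸ k)))) / suc (n + k))) (+-comm 1 (2 * k))))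

  odd : U Γ (2 * n + 1) ≈
    psum n (λ k → mono (sgn (n + k + 1) *ℚ ((+ (2 * (k + 1) * ((2 * n + 1) C (n ∸ k)))) / suc (n + k + 1))) (n + k + 1))
  -- Here at least n + 1 steps go up, and the final height 2k + 1 yields the factor 2(k + 1).
  odd = psum-mono n (suc n) (U Γ (2 * n + 1)) _ (λ k → n + k + 1) (λ k → +-comm (n + k) 1)
    (λ { i (s≤s i≤n) → U-low (2 * n + 1) i (subst (i + i <_) (trans (cong suc (sym 2n≡n+n)) (+-comm 1 (2 * n)))
      (s≤s (+-mono-≤ i≤n i≤n))) })
    (λ i lt → U-high (2 * n + 1) i (subst (_< i) (trans (cong suc (sym 2n≡n+n)) (+-comm 1 (2 * n))) lt))
    (λ k k≤n → trans
      (U-coeff (2 * n + 1) (n + k + 1) (n ∸ k) (2 * k + 1)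
        (trans (cong (_+ 1) (sym (split k≤n)))
          (ℕS.solve 2 (λ x y → x ℕS.:+ y ℕS.:+ ℕS.con 1 ℕS.:= x ℕS.:+ ℕS.con 1 ℕS.:+ y) refl (n + k) (n ∸ k)))
        (trans (cong (_+ 1) (excess k≤n)) (+-assoc (n ∸ k) (2 * k) 1)))
      (cong (λ x → sgn (n + k + 1) *ℚ ((+ (x * ((2 * n + 1) C (n ∸ k)))) / suc (n + k + 1)))
        (ℕS.solve 1 (λ k → ℕS.con 1 ℕS.:+ (ℕS.con 2 ℕS.:* k ℕS.:+ ℕS.con 1) ℕS.:= ℕS.con 2 ℕS.:* (k ℕS.:+ ℕS.con 1)) refl k)))
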